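{- There is a suitable constant $b>1/m$ (for example $b=1.85$) such that for ANF instances on arbitrary directed graphs with $m\ge9$ edges in which every commodity can be routed by itself, and for any $\epsilon$ with $1/m\le\epsilon<1$, the randomized rounding algorithm described in the context, when run on an optimum solution of the compact edge-flow LP, achieves with high probability a $\bigl(1-\epsilon,\;3b\ln m/\ln\ln m\bigr)$-approximation for the ANF problem.
   Context: ANF problem: given a directed graph $G=(V,E)$, $m=|E|$, with capacities $c(e)>0$, and $k$ commodities $(s_i,t_i)$, $s_i\neq t_i$, with demands $d_i>0$ and weights $w_i>0$, $i\in[k]=\{1,\dots,k\}$, choose a set $K'\subseteq[k]$ and for each $i\in K'$ a (fractional, splittable) flow of $d_i$ units from $s_i$ to $t_i$ such that the load (total flow of all chosen commodities) of every edge $e$ is at most $c(e)$; maximize the throughput $\sum_{i\in K'}w_i$. Standing assumption: every commodity can be routed by itself in $G$ within the capacities (others are discarded). An $(\alpha,\beta)$-approximation is a set of commodities with flows fully routing them, whose throughput is at least $\alpha$ times the maximum throughput (under the original capacities) and whose load on every edge $e$ is at most $\beta c(e)$. Compact edge-flow LP: maximize $\sum_iw_if_i$ subject to: the net outflow at $s_i$ of $(f_{i,e})_e$ equals $f_i$ and flow conservation of $(f_{i,e})_e$ holds at all $v\ne s_i,t_i$, for each $i$; $\sum_i d_if_{i,e}\le c(e)$ for all $e$; $d_if_{i,e}\le f_i\,c(e)$ for all $i,e$; $f_{i,e}\ge0$; $f_i\in[0,1]$. Randomized rounding algorithm: let $(\tilde f_i,\tilde f_{i,e})$ be the given solution of the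 compact LP. (Round) Independently for each $i$, set $f_i=1$ with probability $\tilde f_i$ and $f_i=0$ otherwise. (Rescale) Set $f_{i,e}=\frac{\tilde f_{i,e}}{\tilde f_i}f_i$ (and $f_{i,e}=0$ if $f_i=0$); the flow of commodity $i$ on $e$ is $f_{i,e}d_i$. If $\sum_iw_if_i\ge(1-\epsilon)\sum_iw_i\tilde f_i$ and $\sum_if_{i,e}d_i\le(3b\ln m/\ln\ln m)\,c(e)$ for all $e\in E$, return this solution. Otherwise repeat Round and Rescale with fresh randomness, up to $\Theta((\ln m)/\epsilon^2)$ times (with a suitable constant). "With high probability" means with probability at least $1-m^{ -c'}$ for a constant $c'>0$. -}

module Defs where

open import Algebra.Bundles using (CommutativeRing; Semiring)
open import Algebra.Core using (Op₁; Op₂)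
open import Algebra.Structures using (IsCommutativeRing)
open import Axiom.ExcludedMiddle using (ExcludedMiddle)
open import Data.Bool.Base using (Bool; true; false; if_then_else_)
open import Data.Fin.Base using (Fin)
open import Data.Fin.Properties using (_≟_)
open import Data.Fin.Subset using (Subset; _∈_)
open import Data.Maybe.Base using (Maybe; just; nothing)
open import Data.Nat.Base using (ℕ; zero; suc)
open import Data.Product.Base using (Σ; ∃; _×_; _,_)
open import Data.Vec.Base using ([]; _∷_; lookup)
open import Function.Base using (_∘_)
open import Level using (0ℓ)
open import Relation.Binary.Core using (Rel)
open import Relation.Binary.PropositionalEquality.Core using (_≡_; _≢_)
open import Relation.Binary.Structures using (IsTotalOrder)
import Relation.Binary.Construct.NonStrictToStrict as ToStrict
open import Relation.Nullary.Decidable.Core using (does)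
open import Relation.Nullary.Negation.Core using (¬_)

-- The real numbers, given by their characterization up to isomorphism: a
-- totally ordered field in which every inhabited set that is bounded above
-- has a least upper bound.  As with x ⁻¹ at 0, sup is total and its value is
-- unspecified when no least upper bound exists.
record CompleteOrderedField : Set₁ where
  infix  8 _⁻¹
  infix  8 -_
  infixl 7 _*_
  infixl 6 _+_
  infix  4 _≈_ _≤_
  field
    Carrier           : Set
    _≈_               : Rel Carrier 0ℓ
    _≤_               : Rel Carrier 0ℓ
    _+_ _*_           : Op₂ Carrier
    -_ _⁻¹            : Op₁ Carrier
    0# 1#             : Carrier
    isCommutativeRing : IsCommutativeRing _≈_ _+_ _*_ -_ 0# 1#
    isTotalOrder      : IsTotalOrder _≈_ _≤_
    0≉1               : ¬ (0# ≈ 1#)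
    ⁻¹-cong           : ∀ {x y} → x ≈ y → x ⁻¹ ≈ y ⁻¹
    ⁻¹-inverse        : ∀ {x} → ¬ (x ≈ 0#) → x * x ⁻¹ ≈ 1#
    +-monoˡ-≤         : ∀ z {x y} → x ≤ y → x + z ≤ y + z
    *-nonNegative     : ∀ {x y} → 0# ≤ x → 0# ≤ y → 0# ≤ x * y

  IsUpperBound : (Carrier → Set) → Carrier → Set
  IsUpperBound P u = ∀ x → P x → x ≤ u

  IsLeastUpperBound : (Carrier → Set) → Carrier → Set
  IsLeastUpperBound P s = IsUpperBound P s × (∀ u → IsUpperBound P u → s ≤ u)

  field
    sup               : (Carrier → Set) → Carrier
    sup-lub           : ∀ P → ∃ P → ∃ (IsUpperBound P) → IsLeastUpperBound P (sup P)

  commutativeRing : CommutativeRing 0ℓ 0ℓ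
  commutativeRing = record { isCommutativeRing = isCommutativeRing }

  open CommutativeRing commutativeRing public
    using (_-_; semiring)
  open Semiring semiring using (rawSemiring)
  open ToStrict _≈_ _≤_ public using (_<_)
  open import Algebra.Definitions.RawSemiring rawSemiring public
    using (sum; _^_) renaming (_×_ to _·_)

  fromℕ : ℕ → Carrier
  fromℕ n = n · 1#

  -- eˣ = sup { (1 + x/n)ⁿ : n ≥ 1, n ≥ -x }; on this range of n the sequence
  -- is nondecreasing.
  exp : Carrier → Carrier
  exp x = sup λ y → Σ ℕ λ n →
    - x ≤ fromℕ (suc n) × y ≈ (1# + x * fromℕ (suc n) ⁻¹) ^ suc n

  -- Meaningful for x > 0 only.
  ln : Carrier → Carrier
  ln x = sup λ y → exp y ≤ x

  IsCeiling : Carrier → ℕ → Set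
  IsCeiling x n = x ≤ fromℕ n × fromℕ n < x + 1#

-- Classical logic gives every event a probability and lets the algorithm test
-- inequalities between real numbers.
module ANF (em : ExcludedMiddle 0ℓ) (R : CompleteOrderedField) where
  open CompleteOrderedField R renaming (Carrier to ℝ)

  -- Randomized computations: every `flip p` tosses a fresh coin, independent
  -- of all others, that shows true with probability p.
  data Random (A : Set) : Set where
    return : A → Random A
    flip   : ℝ → (Bool → Random A) → Random A

  infixl 1 _>>=_
  _>>=_ : ∀ {A B} → Random A → (A → Random B) → Random B
  return a >>= f = f a
  flip p k >>= f = flip p λ c → k c >>= f

  Pr : ∀ {A} → (A → Set) → Random A → ℝ
  Pr P (return a) = if does (em {P = P a}) then 1# else 0#
  Pr P (flip p k) = p * Pr P (k true) + (1# - p) * Pr P (k false)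

  -- n vertices, m edges, k commodities.  Parallel edges and loops are allowed.
  record Instance (n m k : ℕ) : Set where
    field
      src tgt         : Fin m → Fin n
      capacity        : Fin m → ℝ
      source sink     : Fin k → Fin n
      demand weight   : Fin k → ℝ
      capacity>0      : ∀ e → 0# < capacity e
      source≢sink     : ∀ i → source i ≢ sink i
      demand>0        : ∀ i → 0# < demand i
      weight>0        : ∀ i → 0# < weight i

  module _ {n m k : ℕ} (I : Instance n m k) where
    open Instance I

    netOutflow : (Fin m → ℝ) → Fin n → ℝ
    netOutflow g v = sum (λ e → if does (src e ≟ v) then g e else 0#)
                   - sum (λ e → if does (tgt e ≟ v) then g e else 0#)

    record IsFlow (i : Fin k) (value : ℝ) (g : Fin m → ℝ) : Set where
      field
        nonNegative  : ∀ e → 0# ≤ g e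
        outflow      : netOutflow g (source i) ≈ value
        conservation : ∀ v → v ≢ source i → v ≢ sink i → netOutflow g v ≈ 0#

    RoutableAlone : Fin k → Set
    RoutableAlone i = Σ (Fin m → ℝ) λ g →
      IsFlow i (demand i) g × (∀ e → g e ≤ capacity e)

    -- The flows of commodities outside `chosen` are disregarded.
    record Solution : Set where
      field
        chosen : Subset k
        flow   : Fin k → Fin m → ℝ

      throughput : ℝ
      throughput = sum λ i → if lookup chosen i then weight i else 0#

      load : Fin m → ℝ
      load e = sum λ i → if lookup chosen i then flow i e else 0#

      FullyRouted : Set
      FullyRouted = ∀ i → i ∈ chosen → IsFlow i (demand i) (flow i)

    open Solution

    IsFeasible : Solution → Set
    IsFeasible s = FullyRouted s × (∀ e → load s e ≤ capacity e)

    IsMaximumThroughput : ℝ → Set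
    IsMaximumThroughput t =
      (Σ Solution λ s → IsFeasible s × throughput s ≈ t) ×
      (∀ s → IsFeasible s → throughput s ≤ t)

    record IsApproximation (α β : ℝ) (s : Solution) : Set where
      field
        fullyRouted     : FullyRouted s
        throughputBound : ∀ t → IsMaximumThroughput t → α * t ≤ throughput s
        loadBound       : ∀ e → load s e ≤ β * capacity e

    -- A point of the compact edge-flow LP: `fraction i` is fᵢ and
    -- `edgeFlow i e` is fᵢ,ₑ, which is measured in units of the demand.
    record LPPoint : Set where
      field
        fraction : Fin k → ℝ
        edgeFlow : Fin k → Fin m → ℝ

      objective : ℝ
      objective = sum λ i → weight i * fraction i

    open LPPoint

    record IsLPFeasible (x : LPPoint) : Set where
      field
        isFlow       : ∀ i → IsFlow i (fraction x i) (edgeFlow x i)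
        jointLoad    : ∀ e → sum (λ i → demand i * edgeFlow x i e) ≤ capacity e
        singleLoad   : ∀ i e → demand i * edgeFlow x i e ≤ fraction x i * capacity e
        fraction≥0   : ∀ i → 0# ≤ fraction x i
        fraction≤1   : ∀ i → fraction x i ≤ 1#

    IsLPOptimal : LPPoint → Set
    IsLPOptimal x = IsLPFeasible x × (∀ y → IsLPFeasible y → objective y ≤ objective x)

    rescale : LPPoint → Subset k → LPPoint
    rescale x S .fraction i = if lookup S i then 1# else 0#
    rescale x S .edgeFlow i e =
      if lookup S i then edgeFlow x i e * fraction x i ⁻¹ * 1# else 0#

    toSolution : LPPoint → Subset k → Solution
    toSolution y S .chosen   = S
    toSolution y S .flow i e = edgeFlow y i e * demand i

    Acceptable : (ε β : ℝ) → LPPoint → LPPoint → Set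
    Acceptable ε β x y =
      (1# - ε) * objective x ≤ objective y ×
      (∀ e → sum (λ i → edgeFlow y i e * demand i) ≤ β * capacity e)

  round : ∀ {k} → (Fin k → ℝ) → Random (Subset k)
  round {zero}  p = return []
  round {suc k} p = flip (p Fin.zero) λ c → round (p ∘ Fin.suc) >>= λ S → return (c ∷ S)

  -- At most N rounds; `nothing` if none of them is accepted.
  randomizedRounding : ∀ {n m k} (I : Instance n m k) (ε β : ℝ) (N : ℕ) →
                       LPPoint I → Random (Maybe (Solution I))
  randomizedRounding I ε β zero    x = return nothing
  randomizedRounding I ε β (suc N) x =
    round (LPPoint.fraction x) >>= λ S →
    if does (em {P = Acceptable I ε β x (rescale I x S)})
      then return (just (toSolution I (rescale I x S) S))
      else randomizedRounding I ε β N x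

  Succeeds : ∀ {n m k} (I : Instance n m k) (α β : ℝ) → Maybe (Solution I) → Set
  Succeeds I α β r = Σ (Solution I) λ s → r ≡ just s × IsApproximation I α β s

  -- 3 b ln m / ln ln m
  loadFactor : ℝ → ℕ → ℝ
  loadFactor b m = fromℕ 3 * b * ln (fromℕ m) * ln (ln (fromℕ m)) ⁻¹

-- Chosen commodities have wᵢ ≤ μ, the LP optimum, because each can be routed
-- alone; hence the rounded throughput X has 𝔼 X = μ and 𝔼 X² ≤ 2μ², and
-- X ≥ (1 - ε)μ with probability at least ε²/2 (Paley–Zygmund).  With κ = 3b ≥ 5
-- a Chernoff bound, which needs dᵢ fᵢ,ₑ ≤ fᵢ c(e), shows that the load of an
-- edge exceeds (κ ln m / ln ln m) c(e) with probability at most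
-- m^{-(κ-1)} ≤ m⁻⁴.  The union bound costs at most m⁻³ ≤ ε²/4, so every round is
-- accepted with probability at least ε²/4, and 4 ln m / ε² rounds all fail with
-- probability at most 1/m.
module Submission where

open import Defs
open import Algebra.Bundles using (CommutativeRing)
open import Algebra.Solver.Ring.AlmostCommutativeRing using (fromCommutativeRing; _-Raw-AlmostCommutative⟶_)
open import Axiom.ExcludedMiddle using (ExcludedMiddle)
open import Data.Bool.Base using (Bool; true; false; if_then_else_)
open import Data.Fin.Base using (Fin)
open import Data.Fin.Properties using (_≟_)
open import Data.Fin.Subset using (Subset; ⁅_⁆; ⊥)
open import Data.Fin.Subset.Properties using (x∈⁅y⁆⇒x≡y)
open import Data.Integer.Base as ℤ using (ℤ; +_; -[1+_])
import Data.Integer.Properties as ℤ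
open import Data.Maybe.Base using (Maybe; just; nothing)
open import Data.Nat.Base as ℕ using (ℕ; zero; suc)
import Data.Nat.Properties as ℕ
open import Data.Product.Base using (Σ; ∃; _×_; _,_; proj₁; proj₂)
open import Data.Sum.Base using (inj₁; inj₂)
open import Data.Vec.Base using ([]; _∷_; lookup)
open import Data.Vec.Properties using ([]=⇒lookup; lookup⇒[]=)
open import Function.Base using (_∘_)
open import Level using (0ℓ)
open import Relation.Binary.Bundles using (Poset)
open import Relation.Binary.PropositionalEquality.Core as ≡ using (_≡_)
open import Relation.Binary.Structures using (IsTotalOrder)
import Relation.Binary.Reasoning.PartialOrder as PosetReasoning
import Relation.Binary.Reasoning.Setoid as SetoidReasoning
open import Relation.Nullary.Decidable.Core using (Dec; yes; no; does; decidable-stable)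
open import Relation.Nullary.Negation.Core using (¬_; contradiction)

module RingSolver (R : CompleteOrderedField) where
  open CompleteOrderedField R
  open CommutativeRing commutativeRing
    using (setoid; refl; sym; trans; ring; +-cong; *-cong; -‿cong;
           +-identityˡ; +-identityʳ; +-assoc; +-comm; -‿inverseʳ)
  open import Algebra.Properties.Semiring.Mult semiring using (×-homo-+; ×1-homo-*)
  open import Algebra.Properties.Ring ring
    using (-‿distribˡ-*; -‿distribʳ-*; -0#≈0#; -‿involutive)
  open import Algebra.Properties.AbelianGroup (CommutativeRing.+-abelianGroup commutativeRing)
    using (⁻¹-∙-comm)
  open SetoidReasoning setoid

  -- The clause for 1 makes `con (+ 1)` denote 1# itself rather than 1# + 0#.
  fromℤ⁺ : ℕ → Carrier
  fromℤ⁺ 1 = 1#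
  fromℤ⁺ n = fromℕ n

  fromℤ : ℤ → Carrier
  fromℤ (+ n)    = fromℤ⁺ n
  fromℤ -[1+ n ] = - fromℤ⁺ (suc n)

  fromℤ-+ : ∀ n → fromℤ (+ n) ≈ fromℕ n
  fromℤ-+ 0             = refl
  fromℤ-+ 1             = sym (+-identityʳ 1#)
  fromℤ-+ (suc (suc n)) = refl

  fromℤ-neg : ∀ n → fromℤ -[1+ n ] ≈ - fromℕ (suc n)
  fromℤ-neg n = -‿cong (fromℤ-+ (suc n))

  fromℤ-⊖ : ∀ m n → fromℤ (m ℤ.⊖ n) ≈ fromℕ m - fromℕ n
  fromℤ-⊖ m zero = begin
    fromℤ (m ℤ.⊖ 0)      ≡⟨ ≡.cong fromℤ (ℤ.⊖-≥ {m} ℕ.z≤n) ⟩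
    fromℤ (+ m)          ≈⟨ fromℤ-+ m ⟩
    fromℕ m              ≈⟨ +-identityʳ _ ⟨
    fromℕ m + 0#         ≈⟨ +-cong refl -0#≈0# ⟨
    fromℕ m - 0#         ∎
  fromℤ-⊖ zero (suc n) = trans (fromℤ-neg n) (sym (+-identityˡ _))
  fromℤ-⊖ (suc m) (suc n) = begin
    fromℤ (suc m ℤ.⊖ suc n)                ≡⟨ ≡.cong fromℤ (ℤ.[1+m]⊖[1+n]≡m⊖n m n) ⟩
    fromℤ (m ℤ.⊖ n)                        ≈⟨ fromℤ-⊖ m n ⟩
    fromℕ m - fromℕ n                      ≈⟨ +-cong (+-identityʳ _) refl ⟨
    (fromℕ m + 0#) - fromℕ n               ≈⟨ +-cong (+-cong refl (-‿inverseʳ 1#)) refl ⟨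
    (fromℕ m + (1# - 1#)) - fromℕ n        ≈⟨ +-cong (+-assoc _ _ _) refl ⟨
    ((fromℕ m + 1#) - 1#) - fromℕ n        ≈⟨ +-assoc _ _ _ ⟩
    (fromℕ m + 1#) + (- 1# - fromℕ n)      ≈⟨ +-cong (+-comm _ _) (⁻¹-∙-comm _ _) ⟩
    fromℕ (suc m) - fromℕ (suc n)          ∎

  fromℤ-+-homo : ∀ i j → fromℤ (i ℤ.+ j) ≈ fromℤ i + fromℤ j
  fromℤ-+-homo (+ m) (+ n) = begin
    fromℤ (+ (m ℕ.+ n))          ≈⟨ fromℤ-+ (m ℕ.+ n) ⟩
    fromℕ (m ℕ.+ n)              ≈⟨ ×-homo-+ 1# m n ⟩
    fromℕ m + fromℕ n            ≈⟨ +-cong (fromℤ-+ m) (fromℤ-+ n) ⟨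
    fromℤ (+ m) + fromℤ (+ n)    ∎
  fromℤ-+-homo (+ m) -[1+ n ] =
    trans (fromℤ-⊖ m (suc n)) (+-cong (sym (fromℤ-+ m)) (sym (fromℤ-neg n)))
  fromℤ-+-homo -[1+ m ] (+ n) = begin
    fromℤ (n ℤ.⊖ suc m)            ≈⟨ fromℤ-⊖ n (suc m) ⟩
    fromℕ n - fromℕ (suc m)        ≈⟨ +-comm _ _ ⟩
    - fromℕ (suc m) + fromℕ n      ≈⟨ +-cong (fromℤ-neg m) (fromℤ-+ n) ⟨
    fromℤ -[1+ m ] + fromℤ (+ n)   ∎
  fromℤ-+-homo -[1+ m ] -[1+ n ] = begin
    fromℤ -[1+ suc (m ℕ.+ n) ]           ≡⟨ ≡.cong (λ k → fromℤ -[1+ k ]) (ℕ.+-suc m n) ⟨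
    fromℤ -[1+ m ℕ.+ suc n ]             ≈⟨ fromℤ-neg (m ℕ.+ suc n) ⟩
    - fromℕ (suc m ℕ.+ suc n)            ≈⟨ -‿cong (×-homo-+ 1# (suc m) (suc n)) ⟩
    - (fromℕ (suc m) + fromℕ (suc n))    ≈⟨ ⁻¹-∙-comm _ _ ⟨
    - fromℕ (suc m) - fromℕ (suc n)      ≈⟨ +-cong (fromℤ-neg m) (fromℤ-neg n) ⟨
    fromℤ -[1+ m ] + fromℤ -[1+ n ]      ∎

  fromℤ-neg-homo : ∀ i → fromℤ (ℤ.- i) ≈ - fromℤ i
  fromℤ-neg-homo (+ 0)       = sym -0#≈0#
  fromℤ-neg-homo (+ suc n)   = refl
  fromℤ-neg-homo -[1+ n ]    = sym (-‿involutive _)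

  fromℤ-*-+ : ∀ m n → fromℤ (+ m ℤ.* + n) ≈ fromℤ (+ m) * fromℤ (+ n)
  fromℤ-*-+ m n = begin
    fromℤ (+ m ℤ.* + n)          ≡⟨ ≡.cong fromℤ (ℤ.pos-* m n) ⟨
    fromℤ (+ (m ℕ.* n))          ≈⟨ fromℤ-+ (m ℕ.* n) ⟩
    fromℕ (m ℕ.* n)              ≈⟨ ×1-homo-* m n ⟩
    fromℕ m * fromℕ n            ≈⟨ *-cong (fromℤ-+ m) (fromℤ-+ n) ⟨
    fromℤ (+ m) * fromℤ (+ n)    ∎

  fromℤ-*-homo : ∀ i j → fromℤ (i ℤ.* j) ≈ fromℤ i * fromℤ j
  fromℤ-*-homo (+ m) (+ n) = fromℤ-*-+ m n
  fromℤ-*-homo (+ m) -[1+ n ] = begin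
    fromℤ (+ m ℤ.* -[1+ n ])             ≡⟨ ≡.cong fromℤ (ℤ.neg-distribʳ-* (+ m) (+ suc n)) ⟨
    fromℤ (ℤ.- (+ m ℤ.* + suc n))        ≈⟨ fromℤ-neg-homo (+ m ℤ.* + suc n) ⟩
    - fromℤ (+ m ℤ.* + suc n)            ≈⟨ -‿cong (fromℤ-*-+ m (suc n)) ⟩
    - (fromℤ (+ m) * fromℤ (+ suc n))    ≈⟨ -‿distribʳ-* _ _ ⟩
    fromℤ (+ m) * fromℤ -[1+ n ]         ∎
  fromℤ-*-homo -[1+ m ] (+ n) = begin
    fromℤ (-[1+ m ] ℤ.* + n)             ≡⟨ ≡.cong fromℤ (ℤ.neg-distribˡ-* (+ suc m) (+ n)) ⟨
    fromℤ (ℤ.- (+ suc m ℤ.* + n))        ≈⟨ fromℤ-neg-homo (+ suc m ℤ.* + n) ⟩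
    - fromℤ (+ suc m ℤ.* + n)            ≈⟨ -‿cong (fromℤ-*-+ (suc m) n) ⟩
    - (fromℤ (+ suc m) * fromℤ (+ n))    ≈⟨ -‿distribˡ-* _ _ ⟩
    fromℤ -[1+ m ] * fromℤ (+ n)         ∎
  fromℤ-*-homo -[1+ m ] -[1+ n ] = begin
    fromℤ (+ suc m ℤ.* + suc n)                  ≈⟨ fromℤ-*-+ (suc m) (suc n) ⟩
    fromℤ (+ suc m) * fromℤ (+ suc n)            ≈⟨ -‿involutive _ ⟨
    - (- (fromℤ (+ suc m) * fromℤ (+ suc n)))    ≈⟨ -‿cong (-‿distribˡ-* _ _) ⟩
    - (fromℤ -[1+ m ] * fromℤ (+ suc n))         ≈⟨ -‿distribʳ-* _ _ ⟩
    fromℤ -[1+ m ] * fromℤ -[1+ n ]              ∎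

  ℤ-coefficients : ℤ.+-*-rawRing -Raw-AlmostCommutative⟶ fromCommutativeRing commutativeRing
  ℤ-coefficients = record
    { ⟦_⟧    = fromℤ
    ; +-homo = fromℤ-+-homo
    ; *-homo = fromℤ-*-homo
    ; -‿homo = fromℤ-neg-homo
    ; 0-homo = refl
    ; 1-homo = refl
    }

  fromℤ-≟ : ∀ i j → Maybe (fromℤ i ≈ fromℤ j)
  fromℤ-≟ i j with i ℤ.≟ j
  ... | yes ≡.refl = just refl
  ... | no  _      = nothing

  open import Algebra.Solver.Ring
    ℤ.+-*-rawRing (fromCommutativeRing commutativeRing) ℤ-coefficients fromℤ-≟ public
    using (solve; _:=_; _:+_; _:*_; :-_; _:-_; con)

module OrderedField (R : CompleteOrderedField) where
  open CompleteOrderedField R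
  open CommutativeRing commutativeRing public
    using (setoid; refl; reflexive; sym; trans; +-cong; *-cong; *-congˡ; *-congʳ; +-congˡ; +-congʳ; -‿cong;
           +-identityˡ; +-identityʳ; +-assoc; +-comm; -‿inverseʳ; zeroˡ; zeroʳ;
           *-identityˡ; *-identityʳ; *-assoc; *-comm)
  open IsTotalOrder isTotalOrder public
    using (total; antisym; isPartialOrder)
    renaming (refl to ≤-refl; reflexive to ≤-reflexive; trans to ≤-trans)
  open RingSolver R public
  open import Algebra.Properties.Semiring.Mult semiring using (×-homo-+)
  open import Algebra.Properties.Semiring.Exp semiring using (^-congˡ)

  ≤-poset : Poset 0ℓ 0ℓ 0ℓ
  ≤-poset = record { isPartialOrder = isPartialOrder }

  module ≤-Reasoning = PosetReasoning ≤-poset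
  open ≤-Reasoning

  private variable
    x y z u v : Carrier

  ≰⇒> : ¬ (x ≤ y) → y < x
  ≰⇒> {x} {y} x≰y with total x y
  ... | inj₁ x≤y = contradiction x≤y x≰y
  ... | inj₂ y≤x = y≤x , λ y≈x → x≰y (≤-reflexive (sym y≈x))

  <⇒≤ : x < y → x ≤ y
  <⇒≤ = proj₁

  <⇒≱ : x < y → ¬ (y ≤ x)
  <⇒≱ (x≤y , x≉y) y≤x = x≉y (antisym x≤y y≤x)

  <-≤-trans : x < y → y ≤ z → x < z
  <-≤-trans {x} {y} {z} x<y y≤z = begin-strict x <⟨ x<y ⟩ y ≤⟨ y≤z ⟩ z ∎

  ≤-<-trans : x ≤ y → y < z → x < z
  ≤-<-trans {x} {y} {z} x≤y y<z = begin-strict x ≤⟨ x≤y ⟩ y <⟨ y<z ⟩ z ∎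

  >⇒≉0 : 0# < x → ¬ (x ≈ 0#)
  >⇒≉0 0<x x≈0 = proj₂ 0<x (sym x≈0)

  +-monoʳ-≤ : ∀ z → x ≤ y → z + x ≤ z + y
  +-monoʳ-≤ {x} {y} z x≤y = begin
    z + x ≈⟨ +-comm z x ⟩
    x + z ≤⟨ +-monoˡ-≤ z x≤y ⟩
    y + z ≈⟨ +-comm y z ⟩
    z + y ∎

  +-mono-≤ : x ≤ y → u ≤ v → x + u ≤ y + v
  +-mono-≤ x≤y u≤v = ≤-trans (+-monoˡ-≤ _ x≤y) (+-monoʳ-≤ _ u≤v)

  +-nonNegative : 0# ≤ x → 0# ≤ y → 0# ≤ x + y
  +-nonNegative {x} {y} 0≤x 0≤y = begin
    0#      ≈⟨ +-identityˡ 0# ⟨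
    0# + 0# ≤⟨ +-mono-≤ 0≤x 0≤y ⟩
    x + y   ∎

  ≤-by : ∀ d → 0# ≤ d → x + d ≈ y → x ≤ y
  ≤-by {x} {y} d 0≤d eq = begin
    x      ≈⟨ +-identityʳ x ⟨
    x + 0# ≤⟨ +-monoʳ-≤ x 0≤d ⟩
    x + d  ≈⟨ eq ⟩
    y      ∎

  x≤y⇒0≤y-x : x ≤ y → 0# ≤ y - x
  x≤y⇒0≤y-x {x} {y} x≤y = begin
    0#    ≈⟨ -‿inverseʳ x ⟨
    x - x ≤⟨ +-monoˡ-≤ (- x) x≤y ⟩
    y - x ∎

  x<y⇒0<y-x : x < y → 0# < y - x
  x<y⇒0<y-x {x} {y} x<y = ≰⇒> λ d≤0 → <⇒≱ x<y (begin
    y             ≈⟨ solve 2 (λ x y → y := x :+ (y :- x)) refl x y ⟩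
    x + (y - x)   ≤⟨ +-monoʳ-≤ x d≤0 ⟩
    x + 0#        ≈⟨ +-identityʳ x ⟩
    x             ∎)

  neg-mono-≤ : x ≤ y → - y ≤ - x
  neg-mono-≤ {x} {y} x≤y =
    ≤-by (y - x) (x≤y⇒0≤y-x x≤y) (solve 2 (λ x y → :- y :+ (y :- x) := :- x) refl x y)

  -‿mono-≤ : x ≤ y → u ≤ v → x - v ≤ y - u
  -‿mono-≤ x≤y u≤v = +-mono-≤ x≤y (neg-mono-≤ u≤v)

  *-monoˡ-≤ : 0# ≤ z → x ≤ y → z * x ≤ z * y
  *-monoˡ-≤ {z} {x} {y} 0≤z x≤y = ≤-by (z * (y - x)) (*-nonNegative 0≤z (x≤y⇒0≤y-x x≤y))
    (solve 3 (λ x y z → z :* x :+ z :* (y :- x) := z :* y) refl x y z)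

  *-monoʳ-≤ : 0# ≤ z → x ≤ y → x * z ≤ y * z
  *-monoʳ-≤ {z} {x} {y} 0≤z x≤y = begin
    x * z ≈⟨ *-comm x z ⟩
    z * x ≤⟨ *-monoˡ-≤ 0≤z x≤y ⟩
    z * y ≈⟨ *-comm z y ⟩
    y * z ∎

  *-mono-≤ : 0# ≤ x → x ≤ y → 0# ≤ u → u ≤ v → x * u ≤ y * v
  *-mono-≤ 0≤x x≤y 0≤u u≤v = ≤-trans (*-monoʳ-≤ 0≤u x≤y) (*-monoˡ-≤ (≤-trans 0≤x x≤y) u≤v)

  square-nonNegative : ∀ x → 0# ≤ x * x
  square-nonNegative x with total 0# x
  ... | inj₁ 0≤x = *-nonNegative 0≤x 0≤x
  ... | inj₂ x≤0 = begin
    0#                    ≤⟨ *-nonNegative 0≤-x 0≤-x ⟩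
    - x * - x             ≈⟨ solve 1 (λ x → :- x :* :- x := x :* x) refl x ⟩
    x * x                 ∎
    where
    0≤-x : 0# ≤ - x
    0≤-x = begin
      0#   ≈⟨ solve 0 (con (+ 0) := :- con (+ 0)) refl ⟩
      - 0# ≤⟨ neg-mono-≤ x≤0 ⟩
      - x  ∎

  0≤1 : 0# ≤ 1#
  0≤1 = ≤-trans (square-nonNegative 1#) (≤-reflexive (*-identityˡ 1#))

  0<1 : 0# < 1#
  0<1 = 0≤1 , 0≉1

  *-cancelʳ-≈0 : ¬ (z ≈ 0#) → x * z ≈ 0# → x ≈ 0#
  *-cancelʳ-≈0 {z} {x} z≉0 xz≈0 = begin-equality
    x                ≈⟨ *-identityʳ x ⟨
    x * 1#           ≈⟨ *-congˡ (⁻¹-inverse z≉0) ⟨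
    x * (z * z ⁻¹)   ≈⟨ *-assoc x z (z ⁻¹) ⟨
    (x * z) * z ⁻¹   ≈⟨ *-congʳ xz≈0 ⟩
    0# * z ⁻¹        ≈⟨ zeroˡ _ ⟩
    0#               ∎

  *-positive : 0# < x → 0# < y → 0# < x * y
  *-positive 0<x 0<y =
    *-nonNegative (<⇒≤ 0<x) (<⇒≤ 0<y) ,
    λ 0≈xy → >⇒≉0 0<x (*-cancelʳ-≈0 (>⇒≉0 0<y) (sym 0≈xy))

  *-cancelʳ-≤ : 0# < z → x * z ≤ y * z → x ≤ y
  *-cancelʳ-≤ {z} {x} {y} 0<z xz≤yz with total x y
  ... | inj₁ x≤y = x≤y
  ... | inj₂ y≤x = ≤-reflexive (begin-equality
    x              ≈⟨ solve 2 (λ x y → x := (x :- y) :+ y) refl x y ⟩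
    (x - y) + y    ≈⟨ +-congʳ (*-cancelʳ-≈0 (>⇒≉0 0<z) (antisym [x-y]z≤0 0≤[x-y]z)) ⟩
    0# + y         ≈⟨ +-identityˡ y ⟩
    y              ∎)
    where
    [x-y]z≤0 : (x - y) * z ≤ 0#
    [x-y]z≤0 = ≤-by (y * z - x * z) (x≤y⇒0≤y-x xz≤yz)
      (solve 3 (λ x y z → (x :- y) :* z :+ (y :* z :- x :* z) := con (+ 0)) refl x y z)
    0≤[x-y]z : 0# ≤ (x - y) * z
    0≤[x-y]z = *-nonNegative (x≤y⇒0≤y-x y≤x) (<⇒≤ 0<z)

  ⁻¹-inverseˡ : ¬ (x ≈ 0#) → x ⁻¹ * x ≈ 1#
  ⁻¹-inverseˡ x≉0 = trans (*-comm _ _) (⁻¹-inverse x≉0)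

  ⁻¹-positive : 0# < x → 0# < x ⁻¹
  ⁻¹-positive {x} 0<x = ≰⇒> λ x⁻¹≤0 → <⇒≱ 0<1 (begin
    1#        ≈⟨ ⁻¹-inverse (>⇒≉0 0<x) ⟨
    x * x ⁻¹  ≤⟨ *-monoˡ-≤ (<⇒≤ 0<x) x⁻¹≤0 ⟩
    x * 0#    ≈⟨ zeroʳ x ⟩
    0#        ∎)

  x*y⁻¹*y≈x : ∀ x → 0# < y → x * y ⁻¹ * y ≈ x
  x*y⁻¹*y≈x x 0<y =
    trans (*-assoc _ _ _) (trans (*-congˡ (⁻¹-inverseˡ (>⇒≉0 0<y))) (*-identityʳ x))

  x*y≤z⇒x≤z*y⁻¹ : 0# < y → x * y ≤ z → x ≤ z * y ⁻¹
  x*y≤z⇒x≤z*y⁻¹ {y} {x} {z} 0<y xy≤z = *-cancelʳ-≤ 0<y (begin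
    x * y          ≤⟨ xy≤z ⟩
    z              ≈⟨ x*y⁻¹*y≈x z 0<y ⟨
    z * y ⁻¹ * y   ∎)

  x≤y*z⇒x*z⁻¹≤y : 0# < z → x ≤ y * z → x * z ⁻¹ ≤ y
  x≤y*z⇒x*z⁻¹≤y {z} {x} {y} 0<z x≤yz = *-cancelʳ-≤ 0<z (begin
    x * z ⁻¹ * z   ≈⟨ x*y⁻¹*y≈x x 0<z ⟩
    x              ≤⟨ x≤yz ⟩
    y * z          ∎)

  +-positiveˡ : 0# < x → 0# ≤ y → 0# < x + y
  +-positiveˡ {x} {y} 0<x 0≤y = <-≤-trans 0<x (≤-by y 0≤y refl)

  fromℕ-nonNegative : ∀ n → 0# ≤ fromℕ n
  fromℕ-nonNegative zero    = ≤-refl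
  fromℕ-nonNegative (suc n) = +-nonNegative 0≤1 (fromℕ-nonNegative n)

  fromℕ-positive : ∀ n → 0# < fromℕ (suc n)
  fromℕ-positive n = +-positiveˡ 0<1 (fromℕ-nonNegative n)

  fromℕ-+ : ∀ m n → fromℕ (m ℕ.+ n) ≈ fromℕ m + fromℕ n
  fromℕ-+ = ×-homo-+ 1#

  fromℕ-mono-≤ : ∀ {m n} → m ℕ.≤ n → fromℕ m ≤ fromℕ n
  fromℕ-mono-≤ {m} {n} m≤n = ≤-by (fromℕ (n ℕ.∸ m)) (fromℕ-nonNegative (n ℕ.∸ m))
    (trans (sym (fromℕ-+ m (n ℕ.∸ m))) (reflexive (≡.cong fromℕ (ℕ.m+[n∸m]≡n m≤n))))

  ^-nonNegative : 0# ≤ x → ∀ n → 0# ≤ x ^ n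
  ^-nonNegative 0≤x zero    = 0≤1
  ^-nonNegative 0≤x (suc n) = *-nonNegative 0≤x (^-nonNegative 0≤x n)

  ^-positive : 0# < x → ∀ n → 0# < x ^ n
  ^-positive 0<x zero    = 0<1
  ^-positive 0<x (suc n) = *-positive 0<x (^-positive 0<x n)

  ^-monoˡ-≤ : 0# ≤ x → x ≤ y → ∀ n → x ^ n ≤ y ^ n
  ^-monoˡ-≤ 0≤x x≤y zero    = ≤-refl
  ^-monoˡ-≤ 0≤x x≤y (suc n) = *-mono-≤ 0≤x x≤y (^-nonNegative 0≤x n) (^-monoˡ-≤ 0≤x x≤y n)

  1^n≈1 : ∀ n → 1# ^ n ≈ 1#
  1^n≈1 zero    = refl
  1^n≈1 (suc n) = trans (*-identityˡ _) (1^n≈1 n)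

  ^-above-tangent : ∀ {a b} → 0# ≤ a → 0# ≤ b → ∀ n →
    a ^ n * (fromℕ (suc n) * b - fromℕ n * a) ≤ b ^ suc n
  ^-above-tangent {a} {b} 0≤a 0≤b zero = ≤-reflexive
    (solve 2 (λ a b → con (+ 1) :* ((con (+ 1) :+ con (+ 0)) :* b :- con (+ 0) :* a) := b :* con (+ 1)) refl a b)
  ^-above-tangent {a} {b} 0≤a 0≤b (suc n) = begin
    a * a ^ n * ((1# + (1# + N)) * b - (1# + N) * a)
      ≤⟨ ≤-by (a ^ n * ((1# + N) * ((a - b) * (a - b))))
           (*-nonNegative (^-nonNegative 0≤a n)
             (*-nonNegative (fromℕ-nonNegative (suc n)) (square-nonNegative (a - b))))
           (solve 4 (λ a b p N →
              a :* p :* ((con (+ 1) :+ (con (+ 1) :+ N)) :* b :- (con (+ 1) :+ N) :* a)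
                :+ p :* ((con (+ 1) :+ N) :* ((a :- b) :* (a :- b)))
              := b :* (p :* ((con (+ 1) :+ N) :* b :- N :* a))) refl a b (a ^ n) N) ⟩
    b * (a ^ n * (fromℕ (suc n) * b - N * a))
      ≤⟨ *-monoˡ-≤ 0≤b (^-above-tangent 0≤a 0≤b n) ⟩
    b * b ^ suc n ∎
    where N = fromℕ n

  bernoulli : 0# ≤ 1# + x → ∀ n → 1# + fromℕ (suc n) * x ≤ (1# + x) ^ suc n
  bernoulli {x} 0≤1+x n = begin
    1# + fromℕ (suc n) * x
      ≈⟨ solve 2 (λ x N → con (+ 1) :+ (con (+ 1) :+ N) :* x
           := con (+ 1) :* ((con (+ 1) :+ N) :* (con (+ 1) :+ x) :- N :* con (+ 1))) refl x (fromℕ n) ⟩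
    1# * (fromℕ (suc n) * (1# + x) - fromℕ n * 1#)
      ≈⟨ *-congʳ (1^n≈1 n) ⟨
    1# ^ n * (fromℕ (suc n) * (1# + x) - fromℕ n * 1#)
      ≤⟨ ^-above-tangent 0≤1 0≤1+x n ⟩
    (1# + x) ^ suc n ∎

module Exponential (em : ExcludedMiddle 0ℓ) (R : CompleteOrderedField) where
  open CompleteOrderedField R
  open OrderedField R
  open ≤-Reasoning
  open import Algebra.Properties.Semiring.Exp semiring using (^-congˡ; ^-homo-*)
  open import Algebra.Properties.CommutativeSemiring.Exp
    (CommutativeRing.commutativeSemiring commutativeRing) using (^-distrib-*)

  private variable
    x y s : Carrier

  opaque
    below-sup : ∀ {P h} → IsLeastUpperBound P s → 0# < h → ∃ λ y → P y × s - h ≤ y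
    below-sup {s} {P} {h} (_ , least) 0<h = decidable-stable em λ none →
      <⇒≱ 0<h (begin
        h             ≈⟨ solve 2 (λ s h → h := s :- (s :- h)) refl s h ⟩
        s - (s - h)   ≤⟨ -‿mono-≤ (least (s - h) λ y Py → <⇒≤ (≰⇒> λ s-h≤y → none (y , Py , s-h≤y))) ≤-refl ⟩
        (s - h) - (s - h) ≈⟨ -‿inverseʳ _ ⟩
        0#            ∎)

  opaque
    archimedean : ∀ x → ∃ λ n → x ≤ fromℕ n
    archimedean x = decidable-stable em λ none →
      let bound : IsUpperBound IsNatural x
          bound y (n , y≈n) = ≤-trans (≤-reflexive y≈n) (<⇒≤ (≰⇒> λ x≤n → none (n , x≤n)))
          lub = sup-lub IsNatural (0# , 0 , refl) (x , bound)
          y , (n , y≈n) , s-1≤y = below-sup lub 0<1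
          s = sup IsNatural
      in <⇒≱ (fromℕ-positive 0) (begin
        fromℕ 1 ≈⟨ solve 2 (λ n s → con (+ 1) :+ con (+ 0) := (con (+ 1) :+ (con (+ 1) :+ n)) :+ (:- n :- con (+ 1))) refl (fromℕ n) s ⟩
        fromℕ (suc (suc n)) + (- fromℕ n - 1#) ≤⟨ +-monoˡ-≤ _ (proj₁ lub _ (suc (suc n) , refl)) ⟩
        s + (- fromℕ n - 1#)
          ≈⟨ solve 2 (λ n s → s :+ (:- n :- con (+ 1)) := (s :- con (+ 1)) :- n) refl (fromℕ n) s ⟩
        (s - 1#) - fromℕ n ≤⟨ -‿mono-≤ s-1≤y ≤-refl ⟩
        y - fromℕ n ≈⟨ +-congʳ y≈n ⟩
        fromℕ n - fromℕ n ≈⟨ -‿inverseʳ _ ⟩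
        0# ∎)
      where
      IsNatural : Carrier → Set
      IsNatural y = Σ ℕ λ n → y ≈ fromℕ n

  approx : Carrier → ℕ → Carrier
  approx x n = (1# + x * fromℕ (suc n) ⁻¹) ^ suc n

  Approximates : Carrier → Carrier → Set
  Approximates x y = Σ ℕ λ n → - x ≤ fromℕ (suc n) × y ≈ approx x n

  N*N⁻¹ : ∀ n → fromℕ (suc n) * fromℕ (suc n) ⁻¹ ≈ 1#
  N*N⁻¹ n = ⁻¹-inverse (>⇒≉0 (fromℕ-positive n))

  N*base : ∀ x n → fromℕ (suc n) * (1# + x * fromℕ (suc n) ⁻¹) ≈ fromℕ (suc n) + x
  N*base x n = begin-equality
    fromℕ (suc n) * (1# + x * fromℕ (suc n) ⁻¹)
      ≈⟨ solve 3 (λ N x M → N :* (con (+ 1) :+ x :* M) := N :+ x :* (N :* M)) refl _ x _ ⟩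
    fromℕ (suc n) + x * (fromℕ (suc n) * fromℕ (suc n) ⁻¹)
      ≈⟨ +-congˡ (trans (*-congˡ (N*N⁻¹ n)) (*-identityʳ x)) ⟩
    fromℕ (suc n) + x ∎

  base-nonNegative : ∀ n → - x ≤ fromℕ (suc n) → 0# ≤ 1# + x * fromℕ (suc n) ⁻¹
  base-nonNegative {x} n -x≤N = *-cancelʳ-≤ (fromℕ-positive n) (begin
    0# * N                       ≈⟨ zeroˡ N ⟩
    0#                           ≤⟨ x≤y⇒0≤y-x -x≤N ⟩
    N - (- x)                    ≈⟨ solve 2 (λ N x → N :- :- x := N :+ x) refl N x ⟩
    N + x                        ≈⟨ N*base x n ⟨
    N * (1# + x * N ⁻¹)          ≈⟨ *-comm _ _ ⟩
    (1# + x * N ⁻¹) * N          ∎)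
    where N = fromℕ (suc n)

  base-positive : ∀ n → - x < fromℕ (suc n) → 0# < 1# + x * fromℕ (suc n) ⁻¹
  base-positive {x} n -x<N = ≰⇒> λ base≤0 → <⇒≱ -x<N (begin
    N                       ≈⟨ solve 2 (λ N x → N := (N :+ x) :- x) refl N x ⟩
    (N + x) - x             ≈⟨ +-congʳ (N*base x n) ⟨
    N * (1# + x * N ⁻¹) - x ≤⟨ +-monoˡ-≤ (- x) (*-monoˡ-≤ (fromℕ-nonNegative (suc n)) base≤0) ⟩
    N * 0# - x              ≈⟨ solve 2 (λ N x → N :* con (+ 0) :- x := :- x) refl N x ⟩
    - x                     ∎)
    where N = fromℕ (suc n)

  approx-nonNegative : ∀ n → - x ≤ fromℕ (suc n) → 0# ≤ approx x n
  approx-nonNegative n -x≤N = ^-nonNegative (base-nonNegative n -x≤N) (suc n)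

  approx-cong : x ≈ y → ∀ n → approx x n ≈ approx y n
  approx-cong x≈y n = ^-congˡ (suc n) (+-congˡ (*-congʳ x≈y))

  approx-0 : ∀ n → approx 0# n ≈ 1#
  approx-0 n = trans
    (^-congˡ (suc n) (trans (+-congˡ (zeroˡ _)) (+-identityʳ 1#)))
    (1^n≈1 (suc n))

  fromℕ-step : ∀ n → x ≤ fromℕ (suc n) → x ≤ fromℕ (suc (suc n))
  fromℕ-step n x≤N = ≤-trans x≤N (fromℕ-mono-≤ (ℕ.n≤1+n (suc n)))

  approx-step : ∀ n → - x ≤ fromℕ (suc n) → approx x n ≤ approx x (suc n)
  approx-step {x} n -x≤N = begin
    A ^ suc n
      ≈⟨ *-identityʳ _ ⟨
    A ^ suc n * 1#
      ≈⟨ *-congˡ difference ⟨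
    A ^ suc n * (fromℕ (suc (suc n)) * B - fromℕ (suc n) * A)
      ≤⟨ ^-above-tangent (base-nonNegative n -x≤N) (base-nonNegative (suc n) (fromℕ-step n -x≤N)) (suc n) ⟩
    B ^ suc (suc n) ∎
    where
    A = 1# + x * fromℕ (suc n) ⁻¹
    B = 1# + x * fromℕ (suc (suc n)) ⁻¹
    difference : fromℕ (suc (suc n)) * B - fromℕ (suc n) * A ≈ 1#
    difference = begin-equality
      fromℕ (suc (suc n)) * B - fromℕ (suc n) * A
        ≈⟨ +-cong (N*base x (suc n)) (-‿cong (N*base x n)) ⟩
      (fromℕ (suc (suc n)) + x) - (fromℕ (suc n) + x)
        ≈⟨ solve 2 (λ N x → ((con (+ 1) :+ N) :+ x) :- (N :+ x) := con (+ 1)) refl _ x ⟩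
      1# ∎

  approx-mono : ∀ d n → - x ≤ fromℕ (suc n) → approx x n ≤ approx x (d ℕ.+ n)
  approx-mono zero    n -x≤N = ≤-refl
  approx-mono (suc d) n -x≤N = ≤-trans (approx-mono d n -x≤N)
    (approx-step (d ℕ.+ n) (≤-trans -x≤N (fromℕ-mono-≤ (ℕ.s≤s (ℕ.m≤n+m n d)))))

  neg-+-≤ : ∀ n → - x ≤ fromℕ (suc n) → - y ≤ fromℕ (suc n) →
    - (x + y) ≤ fromℕ (suc (n ℕ.+ suc n))
  neg-+-≤ {x} {y} n -x≤N -y≤N = begin
    - (x + y)                       ≈⟨ solve 2 (λ x y → :- (x :+ y) := :- x :+ :- y) refl x y ⟩
    - x + - y                       ≤⟨ +-mono-≤ -x≤N -y≤N ⟩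
    fromℕ (suc n) + fromℕ (suc n)   ≈⟨ fromℕ-+ (suc n) (suc n) ⟨
    fromℕ (suc n ℕ.+ suc n)         ∎

  -- By AM-GM, (1 + x/N) (1 + y/N) ≤ (1 + (x + y)/2N)².
  approx-* : ∀ n → - x ≤ fromℕ (suc n) → - y ≤ fromℕ (suc n) →
    approx x n * approx y n ≤ approx (x + y) (n ℕ.+ suc n)
  approx-* {x} {y} n -x≤N -y≤N = begin
    A ^ suc n * B ^ suc n       ≈⟨ ^-distrib-* A B (suc n) ⟨
    (A * B) ^ suc n             ≤⟨ ^-monoˡ-≤ (*-nonNegative A≥0 B≥0) AB≤CC (suc n) ⟩
    (C * C) ^ suc n             ≈⟨ ^-distrib-* C C (suc n) ⟩
    C ^ suc n * C ^ suc n       ≈⟨ ^-homo-* C (suc n) (suc n) ⟨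
    C ^ (suc n ℕ.+ suc n)       ∎
    where
    N = fromℕ (suc n)
    A = 1# + x * N ⁻¹
    B = 1# + y * N ⁻¹
    M = fromℕ (suc (n ℕ.+ suc n))
    C = 1# + (x + y) * M ⁻¹
    A≥0 = base-nonNegative n -x≤N
    B≥0 = base-nonNegative n -y≤N
    C+C≈A+B : C + C ≈ A + B
    C+C≈A+B = antisym
      (*-cancelʳ-≤ (fromℕ-positive n) (≤-reflexive eq))
      (*-cancelʳ-≤ (fromℕ-positive n) (≤-reflexive (sym eq)))
      where
      eq : (C + C) * N ≈ (A + B) * N
      eq = begin-equality
        (C + C) * N             ≈⟨ solve 2 (λ C N → (C :+ C) :* N := (N :+ N) :* C) refl C N ⟩
        (N + N) * C             ≈⟨ *-congʳ (fromℕ-+ (suc n) (suc n)) ⟨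
        M * C                   ≈⟨ N*base (x + y) (n ℕ.+ suc n) ⟩
        M + (x + y)             ≈⟨ +-congʳ (fromℕ-+ (suc n) (suc n)) ⟩
        (N + N) + (x + y)       ≈⟨ solve 3 (λ N x y → (N :+ N) :+ (x :+ y) := (N :+ x) :+ (N :+ y)) refl N x y ⟩
        (N + x) + (N + y)       ≈⟨ +-cong (N*base x n) (N*base y n) ⟨
        N * A + N * B           ≈⟨ solve 3 (λ A B N → N :* A :+ N :* B := (A :+ B) :* N) refl A B N ⟩
        (A + B) * N             ∎
    AB≤CC : A * B ≤ C * C
    AB≤CC = *-cancelʳ-≤ (fromℕ-positive 3) (begin
      A * B * fromℕ 4
        ≤⟨ ≤-by ((A - B) * (A - B)) (square-nonNegative (A - B))
             (solve 2 (λ A B → A :* B :* con (+ 4) :+ (A :- B) :* (A :- B) := (A :+ B) :* (A :+ B)) refl A B) ⟩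
      (A + B) * (A + B)
        ≈⟨ *-cong C+C≈A+B C+C≈A+B ⟨
      (C + C) * (C + C)
        ≈⟨ solve 1 (λ C → (C :+ C) :* (C :+ C) := C :* C :* con (+ 4)) refl C ⟩
      C * C * fromℕ 4 ∎)

  opaque
    approximations-* : ∀ {a b} → Approximates x a → Approximates y b →
      ∃ λ c → Approximates (x + y) c × a * b ≤ c
    approximations-* {x} {y} {a} {b} (m , -x≤M , a≈) (n , -y≤N , b≈) =
      approx (x + y) (k ℕ.+ suc k) , (k ℕ.+ suc k , neg-+-≤ k -x≤K -y≤K , refl) , (begin
        a * b                         ≈⟨ *-cong a≈ b≈ ⟩
        approx x m * approx y n
          ≤⟨ *-mono-≤ (approx-nonNegative m -x≤M) (approx-mono n m -x≤M)
                      (approx-nonNegative n -y≤N) ym≤ ⟩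
        approx x k * approx y k       ≤⟨ approx-* k -x≤K -y≤K ⟩
        approx (x + y) (k ℕ.+ suc k)  ∎)
      where
      k : ℕ
      k = n ℕ.+ m
      ym≤ : approx y n ≤ approx y k
      ym≤ = ≤-trans (approx-mono m n -y≤N) (≤-reflexive (reflexive (≡.cong (approx y) (ℕ.+-comm m n))))
      -x≤K : - x ≤ fromℕ (suc k)
      -x≤K = ≤-trans -x≤M (fromℕ-mono-≤ (ℕ.s≤s (ℕ.m≤n+m m n)))
      -y≤K : - y ≤ fromℕ (suc k)
      -y≤K = ≤-trans -y≤N (fromℕ-mono-≤ (ℕ.s≤s (ℕ.m≤m+n n m)))

  opaque
    approximable : ∀ x → ∃ λ n → - x < fromℕ (suc n)
    approximable x with archimedean (- x)
    ... | n , -x≤n = n , ≤-<-trans -x≤n (fromℕ<fromℕ-suc n)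
      where
      fromℕ<fromℕ-suc : ∀ n → fromℕ n < fromℕ (suc n)
      fromℕ<fromℕ-suc n = ≰⇒> λ N+1≤N → <⇒≱ 0<1 (begin
        1#                    ≈⟨ solve 1 (λ N → con (+ 1) := (con (+ 1) :+ N) :- N) refl (fromℕ n) ⟩
        fromℕ (suc n) - fromℕ n ≤⟨ +-monoˡ-≤ _ N+1≤N ⟩
        fromℕ n - fromℕ n     ≈⟨ -‿inverseʳ _ ⟩
        0#                    ∎)

  opaque
    exp-lub : ∀ x → IsLeastUpperBound (Approximates x) (exp x)
    exp-lub x with approximable x | approximable (- x)
    ... | n , -x<N | m , x<M = sup-lub (Approximates x) (approx x n , n , <⇒≤ -x<N , refl)
      (1# * approx (- x) m ⁻¹ , λ a Pa →
        x*y≤z⇒x≤z*y⁻¹ (^-positive (base-positive m x<M) (suc m)) (bound a Pa))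
      where
      bound : ∀ a → Approximates x a → a * approx (- x) m ≤ 1#
      bound a Pa with approximations-* Pa (m , <⇒≤ x<M , refl)
      ... | c , (k , _ , c≈) , le = begin
        a * approx (- x) m   ≤⟨ le ⟩
        c                    ≈⟨ c≈ ⟩
        approx (x - x) k     ≈⟨ approx-cong (-‿inverseʳ x) k ⟩
        approx 0# k          ≈⟨ approx-0 k ⟩
        1#                   ∎

  approx≤exp : ∀ n → - x ≤ fromℕ (suc n) → approx x n ≤ exp x
  approx≤exp {x} n -x≤N = proj₁ (exp-lub x) _ (n , -x≤N , refl)

  exp-positive : ∀ x → 0# < exp x
  exp-positive x with approximable x
  ... | n , -x<N = <-≤-trans (^-positive (base-positive n -x<N) (suc n)) (approx≤exp n (<⇒≤ -x<N))

  1+x≤exp : ∀ x → 1# + x ≤ exp x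
  1+x≤exp x with total (- x) (fromℕ 1)
  ... | inj₁ -x≤1 = ≤-trans 1+x≤approx (approx≤exp 0 -x≤1)
    where
    1+x≤approx : 1# + x ≤ approx x 0
    1+x≤approx = ≤-reflexive (begin-equality
      1# + x                                   ≈⟨ +-congʳ (+-identityʳ 1#) ⟨
      fromℕ 1 + x                              ≈⟨ N*base x 0 ⟨
      fromℕ 1 * (1# + x * fromℕ 1 ⁻¹)          ≈⟨ solve 1 (λ a → (con (+ 1) :+ con (+ 0)) :* a := a :* con (+ 1)) refl _ ⟩
      (1# + x * fromℕ 1 ⁻¹) ^ 1                ∎)
  ... | inj₂ 1≤-x = begin
    1# + x        ≈⟨ solve 1 (λ x → con (+ 1) :+ x := (con (+ 1) :+ con (+ 0)) :- :- x) refl x ⟩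
    fromℕ 1 - - x ≤⟨ -‿mono-≤ 1≤-x ≤-refl ⟩
    - x - - x     ≈⟨ -‿inverseʳ _ ⟩
    0#            ≤⟨ <⇒≤ (exp-positive x) ⟩
    exp x         ∎

  lub-*-≤ : ∀ {P c d} → IsLeastUpperBound P s → 0# < c → (∀ a → P a → a * c ≤ d) → s * c ≤ d
  lub-*-≤ {s} {P} {c} {d} (_ , least) 0<c bound = begin
    s * c            ≤⟨ *-monoʳ-≤ (<⇒≤ 0<c) (least (d * c ⁻¹) λ a Pa → x*y≤z⇒x≤z*y⁻¹ 0<c (bound a Pa)) ⟩
    d * c ⁻¹ * c     ≈⟨ x*y⁻¹*y≈x d 0<c ⟩
    d                ∎

  exp-≤-lub : ∀ {u} → (∀ n → - x ≤ fromℕ (suc n) → approx x n ≤ u) → exp x ≤ u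
  exp-≤-lub {x} bound = proj₂ (exp-lub x) _ λ { y (n , -x≤N , y≈) → ≤-trans (≤-reflexive y≈) (bound n -x≤N) }

  exp-cong-≤ : x ≈ y → exp x ≤ exp y
  exp-cong-≤ x≈y = exp-≤-lub λ n -x≤N →
    ≤-trans (≤-reflexive (approx-cong x≈y n)) (approx≤exp n (≤-trans (≤-reflexive (-‿cong (sym x≈y))) -x≤N))

  exp-cong : x ≈ y → exp x ≈ exp y
  exp-cong x≈y = antisym (exp-cong-≤ x≈y) (exp-cong-≤ (sym x≈y))

  exp-0 : exp 0# ≈ 1#
  exp-0 = antisym
    (exp-≤-lub λ n _ → ≤-reflexive (approx-0 n))
    (≤-trans (≤-reflexive (sym (+-identityʳ 1#))) (1+x≤exp 0#))

  exp-*-≤ : ∀ x y → exp x * exp y ≤ exp (x + y)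
  exp-*-≤ x y = lub-*-≤ (exp-lub x) (exp-positive y) λ a Pa →
    ≤-trans (≤-reflexive (*-comm a (exp y))) (exp-*-approx a Pa em)
    where
    exp-*-approx : ∀ a → Approximates x a → Dec (a ≈ 0#) → exp y * a ≤ exp (x + y)
    exp-*-approx a Pa (yes a≈0) =
      ≤-trans (≤-reflexive (trans (*-congˡ a≈0) (zeroʳ _))) (<⇒≤ (exp-positive (x + y)))
    exp-*-approx a Pa@(n , -x≤N , a≈) (no a≉0) = lub-*-≤ (exp-lub y)
      (≤-trans (approx-nonNegative n -x≤N) (≤-reflexive (sym a≈)) , λ 0≈a → a≉0 (sym 0≈a))
      λ b Pb → let c , Pc , ab≤c = approximations-* Pa Pb in
        ≤-trans (≤-reflexive (*-comm b a)) (≤-trans ab≤c (proj₁ (exp-lub (x + y)) c Pc))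

  -- (1 + x/N)ᴺ (1 - x/N)ᴺ = (1 - x²/N²)ᴺ ≥ 1 - x²/N.
  N-x²≤N*exp-*-exp-neg : ∀ n → x ≤ fromℕ (suc n) → - x ≤ fromℕ (suc n) →
    fromℕ (suc n) - x * x ≤ fromℕ (suc n) * (exp x * exp (- x))
  N-x²≤N*exp-*-exp-neg {x} n x≤N -x≤N = begin
    N - x * x
      ≈⟨ +-cong (sym (*-identityʳ N)) (-‿cong (sym (trans (*-congˡ (trans (*-cong (N*N⁻¹ n) (N*N⁻¹ n)) (*-identityˡ 1#))) (*-identityʳ _)))) ⟩
    N * 1# - x * x * (N * N ⁻¹ * (N * N ⁻¹))
      ≈⟨ solve 3 (λ N M x → N :* con (+ 1) :- x :* x :* (N :* M :* (N :* M))
           := N :* (con (+ 1) :+ N :* (:- (x :* M :* (x :* M))))) refl N (N ⁻¹) x ⟩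
    N * (1# + N * - (x * N ⁻¹ * (x * N ⁻¹)))
      ≤⟨ *-monoˡ-≤ N≥0 (bernoulli (≤-trans (*-nonNegative A≥0 B≥0) (≤-reflexive AB≈)) n) ⟩
    N * (1# + - (x * N ⁻¹ * (x * N ⁻¹))) ^ suc n
      ≈⟨ *-congˡ (^-congˡ (suc n) AB≈) ⟨
    N * ((1# + x * N ⁻¹) * (1# + - x * N ⁻¹)) ^ suc n
      ≈⟨ *-congˡ (^-distrib-* _ _ (suc n)) ⟩
    N * (approx x n * approx (- x) n)
      ≤⟨ *-monoˡ-≤ N≥0 (*-mono-≤ (approx-nonNegative n -x≤N) (approx≤exp n -x≤N)
           (approx-nonNegative n x≤N′) (approx≤exp n x≤N′)) ⟩
    N * (exp x * exp (- x)) ∎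
    where
    N = fromℕ (suc n)
    N≥0 = fromℕ-nonNegative (suc n)
    x≤N′ : - - x ≤ N
    x≤N′ = ≤-trans (≤-reflexive (solve 1 (λ x → :- :- x := x) refl x)) x≤N
    A≥0 = base-nonNegative n -x≤N
    B≥0 = base-nonNegative n x≤N′
    AB≈ : (1# + x * N ⁻¹) * (1# + - x * N ⁻¹) ≈ 1# + - (x * N ⁻¹ * (x * N ⁻¹))
    AB≈ = solve 2 (λ x M → (con (+ 1) :+ x :* M) :* (con (+ 1) :+ :- x :* M)
      := con (+ 1) :+ :- (x :* M :* (x :* M))) refl x (N ⁻¹)

  1≤exp-*-exp-neg : ∀ x → 1# ≤ exp x * exp (- x)
  1≤exp-*-exp-neg x = decidable-stable em λ 1≰v → absurd (≰⇒> 1≰v)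
    where
    v = exp x * exp (- x)
    absurd : ¬ (v < 1#)
    absurd v<1 with archimedean x | archimedean (- x) | archimedean (x * x * (1# - v) ⁻¹)
    ... | a , x≤a | b , -x≤b | c , x²/u≤c = <⇒≱ 0<u (begin
      1# - v
        ≈⟨ solve 2 (λ v n → con (+ 1) :- v := ((con (+ 1) :+ n) :- (con (+ 1) :+ n) :* v) :- n :* (con (+ 1) :- v)) refl v (fromℕ n) ⟩
      (fromℕ (suc n) - fromℕ (suc n) * v) - fromℕ n * (1# - v)
        ≤⟨ -‿mono-≤ (-‿mono-≤ ≤-refl (N-x²≤N*exp-*-exp-neg n x≤N -x≤N)) ≤-refl ⟩
      (fromℕ (suc n) - (fromℕ (suc n) - x * x)) - fromℕ n * (1# - v)
        ≈⟨ solve 3 (λ x v n → ((con (+ 1) :+ n) :- ((con (+ 1) :+ n) :- x :* x)) :- n :* (con (+ 1) :- v)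
             := x :* x :- n :* (con (+ 1) :- v)) refl x v (fromℕ n) ⟩
      x * x - fromℕ n * (1# - v)
        ≤⟨ -‿mono-≤ (≤-reflexive (sym (x*y⁻¹*y≈x (x * x) 0<u))) ≤-refl ⟩
      x * x * (1# - v) ⁻¹ * (1# - v) - fromℕ n * (1# - v)
        ≤⟨ -‿mono-≤ (*-monoʳ-≤ (<⇒≤ 0<u) (≤-trans x²/u≤c (fromℕ-mono-≤ (ℕ.m≤n+m c (a ℕ.+ b))))) ≤-refl ⟩
      fromℕ n * (1# - v) - fromℕ n * (1# - v)
        ≈⟨ -‿inverseʳ _ ⟩
      0# ∎)
      where
      n = a ℕ.+ b ℕ.+ c
      0<u : 0# < 1# - v
      0<u = x<y⇒0<y-x v<1
      x≤N : x ≤ fromℕ (suc n)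
      x≤N = ≤-trans x≤a (fromℕ-mono-≤ (ℕ.m≤n⇒m≤1+n (ℕ.≤-trans (ℕ.m≤m+n a b) (ℕ.m≤m+n (a ℕ.+ b) c))))
      -x≤N : - x ≤ fromℕ (suc n)
      -x≤N = ≤-trans -x≤b (fromℕ-mono-≤ (ℕ.m≤n⇒m≤1+n (ℕ.≤-trans (ℕ.m≤n+m b a) (ℕ.m≤m+n (a ℕ.+ b) c))))

  exp-+ : ∀ x y → exp (x + y) ≈ exp x * exp y
  exp-+ x y = antisym (begin
    exp (x + y)                             ≈⟨ *-identityʳ _ ⟨
    exp (x + y) * 1#                        ≤⟨ *-monoˡ-≤ (<⇒≤ (exp-positive _)) (1≤exp-*-exp-neg y) ⟩
    exp (x + y) * (exp y * exp (- y))       ≈⟨ solve 3 (λ a b c → a :* (b :* c) := a :* c :* b) refl _ _ _ ⟩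
    exp (x + y) * exp (- y) * exp y         ≤⟨ *-monoʳ-≤ (<⇒≤ (exp-positive y)) (exp-*-≤ (x + y) (- y)) ⟩
    exp ((x + y) - y) * exp y               ≈⟨ *-congʳ (exp-cong (solve 2 (λ x y → (x :+ y) :- y := x) refl x y)) ⟩
    exp x * exp y                           ∎)
    (exp-*-≤ x y)

  exp-neg : ∀ x → exp x * exp (- x) ≈ 1#
  exp-neg x = begin-equality
    exp x * exp (- x)   ≈⟨ exp-+ x (- x) ⟨
    exp (x - x)         ≈⟨ exp-cong (-‿inverseʳ x) ⟩
    exp 0#              ≈⟨ exp-0 ⟩
    1#                  ∎

  exp-mono-≤ : x ≤ y → exp x ≤ exp y
  exp-mono-≤ {x} {y} x≤y = begin
    exp x                   ≈⟨ *-identityʳ _ ⟨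
    exp x * 1#              ≤⟨ *-monoˡ-≤ (<⇒≤ (exp-positive x)) 1≤exp ⟩
    exp x * exp (y - x)     ≈⟨ exp-+ x (y - x) ⟨
    exp (x + (y - x))       ≈⟨ exp-cong (solve 2 (λ x y → x :+ (y :- x) := y) refl x y) ⟩
    exp y                   ∎
    where
    1≤exp : 1# ≤ exp (y - x)
    1≤exp = ≤-trans (≤-by (y - x) (x≤y⇒0≤y-x x≤y) refl) (1+x≤exp (y - x))

  exp-cancel-< : exp x < exp y → x < y
  exp-cancel-< ex<ey = ≰⇒> λ y≤x → <⇒≱ ex<ey (exp-mono-≤ y≤x)

  exp-convex : ∀ {a} t → 0# ≤ a → a ≤ 1# → exp (t * a) ≤ 1# + a * (exp t - 1#)
  exp-convex {a} t 0≤a a≤1 = begin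
    e
      ≈⟨ solve 3 (λ e a t → e := a :* (e :* (con (+ 1) :+ (t :- t :* a))) :+ (con (+ 1) :- a) :* (e :* (con (+ 1) :- t :* a))) refl e a t ⟩
    a * (e * (1# + (t - t * a))) + (1# - a) * (e * (1# - t * a))
      ≤⟨ +-mono-≤ (*-monoˡ-≤ 0≤a (tangent (t - t * a))) (*-monoˡ-≤ (x≤y⇒0≤y-x a≤1) (tangent (- (t * a)))) ⟩
    a * (exp (t * a + (t - t * a))) + (1# - a) * exp (t * a - t * a)
      ≈⟨ +-cong (*-congˡ (exp-cong (solve 2 (λ s t → s :+ (t :- s) := t) refl (t * a) t)))
                (*-congˡ (trans (exp-cong (-‿inverseʳ _)) exp-0)) ⟩
    a * exp t + (1# - a) * 1#
      ≈⟨ solve 2 (λ a u → a :* u :+ (con (+ 1) :- a) :* con (+ 1) := con (+ 1) :+ a :* (u :- con (+ 1))) refl a (exp t) ⟩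
    1# + a * (exp t - 1#) ∎
    where
    e = exp (t * a)
    tangent : ∀ h → e * (1# + h) ≤ exp (t * a + h)
    tangent h = ≤-trans (*-monoˡ-≤ (<⇒≤ (exp-positive _)) (1+x≤exp h)) (≤-reflexive (sym (exp-+ _ h)))

  approach : ∀ {a b} → 0# < a → (∀ h → 0# < h → a * (1# - h) ≤ b) → a ≤ b
  approach {a} {b} 0<a bound = decidable-stable em λ a≰b → absurd (≰⇒> a≰b)
    where
    absurd : ¬ (b < a)
    absurd b<a = <⇒≱ 0<d (begin
      d
        ≈⟨ solve 2 (λ a b → a :- b := ((a :+ a) :- (a :- b)) :- (b :+ b)) refl a b ⟩
      ((a + a) - d) - (b + b)
        ≈⟨ +-congʳ (+-congˡ (-‿cong (x*y⁻¹*y≈x d 0<a+a))) ⟨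
      ((a + a) - h * (a + a)) - (b + b)
        ≈⟨ solve 3 (λ a b h → ((a :+ a) :- h :* (a :+ a)) :- (b :+ b)
             := (a :* (con (+ 1) :- h) :+ a :* (con (+ 1) :- h)) :- (b :+ b)) refl a b h ⟩
      (a * (1# - h) + a * (1# - h)) - (b + b)
        ≤⟨ +-monoˡ-≤ _ (+-mono-≤ (bound h 0<h) (bound h 0<h)) ⟩
      (b + b) - (b + b)
        ≈⟨ -‿inverseʳ _ ⟩
      0# ∎)
      where
      d = a - b
      0<d = x<y⇒0<y-x b<a
      0<a+a = +-positiveˡ 0<a (<⇒≤ 0<a)
      h = d * (a + a) ⁻¹
      0<h = *-positive 0<d (⁻¹-positive 0<a+a)

  opaque
    ln-lub : 0# < x → IsLeastUpperBound (λ y → exp y ≤ x) (ln x)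
    ln-lub {x} 0<x = sup-lub (λ y → exp y ≤ x)
      (- z , inhabited)
      (x , λ y ey≤x → ≤-trans (≤-by 1# 0≤1 (+-comm y 1#)) (≤-trans (1+x≤exp y) ey≤x))
      where
      z : Carrier
      z = x ⁻¹
      0<z : 0# < z
      0<z = ⁻¹-positive 0<x
      z≤exp : z ≤ exp z
      z≤exp = ≤-trans (≤-by 1# 0≤1 (+-comm z 1#)) (1+x≤exp z)
      inhabited : exp (- z) ≤ x
      inhabited = *-cancelʳ-≤ 0<z (begin
        exp (- z) * z       ≤⟨ *-monoˡ-≤ (<⇒≤ (exp-positive _)) z≤exp ⟩
        exp (- z) * exp z   ≈⟨ *-comm _ _ ⟩
        exp z * exp (- z)   ≈⟨ exp-neg z ⟩
        1#                  ≈⟨ ⁻¹-inverse (>⇒≉0 0<x) ⟨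
        x * z               ∎)

  exp-ln-≤ : 0# < x → exp (ln x) ≤ x
  exp-ln-≤ {x} 0<x = approach (exp-positive _) λ h 0<h →
    let y , ey≤x , s-h≤y = below-sup (ln-lub 0<x) 0<h in begin
      exp (ln x) * (1# - h)      ≤⟨ *-monoˡ-≤ (<⇒≤ (exp-positive _)) (1+x≤exp (- h)) ⟩
      exp (ln x) * exp (- h)     ≈⟨ exp-+ (ln x) (- h) ⟨
      exp (ln x - h)             ≤⟨ exp-mono-≤ s-h≤y ⟩
      exp y                      ≤⟨ ey≤x ⟩
      x                          ∎

  ≤-exp-ln : 0# < x → x ≤ exp (ln x)
  ≤-exp-ln {x} 0<x = approach 0<x λ h 0<h → begin
    x * (1# - h)
      ≤⟨ *-monoˡ-≤ (<⇒≤ 0<x) (1+x≤exp (- h)) ⟩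
    x * exp (- h)
      ≤⟨ *-monoʳ-≤ (<⇒≤ (exp-positive _)) (<⇒≤ (≰⇒> λ ≤x → <⇒≱ 0<h (h≤0 (proj₁ (ln-lub 0<x) _ ≤x)))) ⟩
    exp (ln x + h) * exp (- h)
      ≈⟨ exp-+ (ln x + h) (- h) ⟨
    exp ((ln x + h) - h)
      ≈⟨ exp-cong (solve 2 (λ s h → (s :+ h) :- h := s) refl (ln x) h) ⟩
    exp (ln x) ∎
    where
    h≤0 : ∀ {s h} → s + h ≤ s → h ≤ 0#
    h≤0 {s} {h} le = begin
      h             ≈⟨ solve 2 (λ s h → h := (s :+ h) :- s) refl s h ⟩
      (s + h) - s   ≤⟨ +-monoˡ-≤ _ le ⟩
      s - s         ≈⟨ -‿inverseʳ s ⟩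
      0#            ∎

module FiniteSums (R : CompleteOrderedField) where
  open CompleteOrderedField R
  open OrderedField R
  open ≤-Reasoning
  open import Algebra.Properties.Semiring.Sum semiring public
    using (sum-cong-≋; *-distribˡ-sum)

  sum-mono-≤ : ∀ {k} {f g : Fin k → Carrier} → (∀ i → f i ≤ g i) → sum f ≤ sum g
  sum-mono-≤ {zero}  f≤g = ≤-refl
  sum-mono-≤ {suc k} f≤g = +-mono-≤ (f≤g Fin.zero) (sum-mono-≤ (f≤g ∘ Fin.suc))

  sum-nonNegative : ∀ {k} {f : Fin k → Carrier} → (∀ i → 0# ≤ f i) → 0# ≤ sum f
  sum-nonNegative {zero}  0≤f = ≤-refl
  sum-nonNegative {suc k} 0≤f = +-nonNegative (0≤f Fin.zero) (sum-nonNegative (0≤f ∘ Fin.suc))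

  term≤sum : ∀ {k} {f : Fin k → Carrier} → (∀ i → 0# ≤ f i) → ∀ i → f i ≤ sum f
  term≤sum 0≤f Fin.zero    = ≤-by _ (sum-nonNegative (0≤f ∘ Fin.suc)) refl
  term≤sum {f = f} 0≤f (Fin.suc i) =
    ≤-trans (term≤sum (0≤f ∘ Fin.suc) i) (≤-by (f Fin.zero) (0≤f Fin.zero) (+-comm _ _))

  sum-const : ∀ k c → sum {k} (λ _ → c) ≈ fromℕ k * c
  sum-const zero    c = sym (zeroˡ c)
  sum-const (suc k) c = begin-equality
    c + sum {k} (λ _ → c)   ≈⟨ +-congˡ (sum-const k c) ⟩
    c + fromℕ k * c         ≈⟨ solve 2 (λ c k → c :+ k :* c := (con (+ 1) :+ k) :* c) refl c (fromℕ k) ⟩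
    fromℕ (suc k) * c       ∎

  sumOver : ∀ {k} → Subset k → (Fin k → Carrier) → Carrier
  sumOver S u = sum λ i → if lookup S i then u i else 0#

  if-nonNegative : ∀ b {x} → 0# ≤ x → 0# ≤ (if b then x else 0#)
  if-nonNegative true  0≤x = 0≤x
  if-nonNegative false 0≤x = ≤-refl

  if-* : ∀ b x y → (if b then x * y else 0#) ≈ x * (if b then y else 0#)
  if-* true  x y = refl
  if-* false x y = sym (zeroʳ x)

  sumOver-nonNegative : ∀ {k} (S : Subset k) {u} → (∀ i → 0# ≤ u i) → 0# ≤ sumOver S u
  sumOver-nonNegative S 0≤u = sum-nonNegative λ i → if-nonNegative (lookup S i) (0≤u i)

  sumOver-* : ∀ {k} (S : Subset k) x u → sumOver S (λ i → x * u i) ≈ x * sumOver S u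
  sumOver-* S x u = trans
    (sum-cong-≋ λ i → if-* (lookup S i) x (u i))
    (sym (*-distribˡ-sum x λ i → if lookup S i then u i else 0#))

module RandomSubset (em : ExcludedMiddle 0ℓ) (R : CompleteOrderedField) where
  open CompleteOrderedField R renaming (Carrier to ℝ)
  open OrderedField R
  open FiniteSums R
  open Exponential em R
  open ≤-Reasoning

  𝟙 : Set → ℝ
  𝟙 P = if does (em {P = P}) then 1# else 0#

  𝟙-true : ∀ {P} → P → 𝟙 P ≈ 1#
  𝟙-true {P} Px with em {P = P}
  ... | yes _  = refl
  ... | no  ¬P = contradiction Px ¬P

  𝟙-false : ∀ {P} → ¬ P → 𝟙 P ≈ 0#
  𝟙-false {P} ¬P with em {P = P}
  ... | yes Px = contradiction Px ¬P
  ... | no  _  = refl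

  𝟙-nonNegative : ∀ P → 0# ≤ 𝟙 P
  𝟙-nonNegative P with em {P = P}
  ... | yes _ = 0≤1
  ... | no  _ = ≤-refl

  𝟙≤1 : ∀ P → 𝟙 P ≤ 1#
  𝟙≤1 P with em {P = P}
  ... | yes _ = ≤-refl
  ... | no  _ = 0≤1

  𝔼 : ∀ {k} → (Fin k → ℝ) → (Subset k → ℝ) → ℝ
  𝔼 {zero}  p f = f []
  𝔼 {suc k} p f = p Fin.zero * 𝔼 (p ∘ Fin.suc) (f ∘ (true ∷_))
                + (1# - p Fin.zero) * 𝔼 (p ∘ Fin.suc) (f ∘ (false ∷_))

  IsProbability : ∀ {k} → (Fin k → ℝ) → Set
  IsProbability p = ∀ i → 0# ≤ p i × p i ≤ 1#

  Supported : ∀ {k} → (Fin k → ℝ) → Subset k → Set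
  Supported p S = ∀ i → lookup S i ≡ true → ¬ (p i ≈ 0#)

  private variable
    k : ℕ
    p : Fin k → ℝ
    f g : Subset k → ℝ

  𝔼-cong : ∀ (p : Fin k → ℝ) → (∀ S → f S ≈ g S) → 𝔼 p f ≈ 𝔼 p g
  𝔼-cong {zero}  p f≈g = f≈g []
  𝔼-cong {suc k} p f≈g =
    +-cong (*-congˡ (𝔼-cong (p ∘ Fin.suc) (f≈g ∘ (true ∷_)))) (*-congˡ (𝔼-cong (p ∘ Fin.suc) (f≈g ∘ (false ∷_))))

  𝔼-const : ∀ (p : Fin k → ℝ) c → 𝔼 p (λ _ → c) ≈ c
  𝔼-const {zero}  p c = refl
  𝔼-const {suc k} p c = begin-equality
    p₀ * 𝔼 (p ∘ Fin.suc) (λ _ → c) + (1# - p₀) * 𝔼 (p ∘ Fin.suc) (λ _ → c)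
      ≈⟨ +-cong (*-congˡ (𝔼-const (p ∘ Fin.suc) c)) (*-congˡ (𝔼-const (p ∘ Fin.suc) c)) ⟩
    p₀ * c + (1# - p₀) * c
      ≈⟨ solve 2 (λ p c → p :* c :+ (con (+ 1) :- p) :* c := c) refl p₀ c ⟩
    c ∎
    where p₀ = p Fin.zero

  𝔼-+ : ∀ (p : Fin k → ℝ) f g → 𝔼 p (λ S → f S + g S) ≈ 𝔼 p f + 𝔼 p g
  𝔼-+ {zero}  p f g = refl
  𝔼-+ {suc k} p f g = begin-equality
    p₀ * 𝔼 p′ (λ S → f (true ∷ S) + g (true ∷ S)) + (1# - p₀) * 𝔼 p′ (λ S → f (false ∷ S) + g (false ∷ S))
      ≈⟨ +-cong (*-congˡ (𝔼-+ p′ _ _)) (*-congˡ (𝔼-+ p′ _ _)) ⟩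
    p₀ * (𝔼 p′ (f ∘ (true ∷_)) + 𝔼 p′ (g ∘ (true ∷_)))
      + (1# - p₀) * (𝔼 p′ (f ∘ (false ∷_)) + 𝔼 p′ (g ∘ (false ∷_)))
      ≈⟨ solve 6 (λ p q a b c d → p :* (a :+ b) :+ q :* (c :+ d) := (p :* a :+ q :* c) :+ (p :* b :+ q :* d))
           refl p₀ (1# - p₀) _ _ _ _ ⟩
    𝔼 p f + 𝔼 p g ∎
    where
    p₀ = p Fin.zero
    p′ = p ∘ Fin.suc

  𝔼-* : ∀ (p : Fin k → ℝ) c f → 𝔼 p (λ S → c * f S) ≈ c * 𝔼 p f
  𝔼-* {zero}  p c f = refl
  𝔼-* {suc k} p c f = begin-equality
    p₀ * 𝔼 p′ (λ S → c * f (true ∷ S)) + (1# - p₀) * 𝔼 p′ (λ S → c * f (false ∷ S))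
      ≈⟨ +-cong (*-congˡ (𝔼-* p′ c _)) (*-congˡ (𝔼-* p′ c _)) ⟩
    p₀ * (c * 𝔼 p′ (f ∘ (true ∷_))) + (1# - p₀) * (c * 𝔼 p′ (f ∘ (false ∷_)))
      ≈⟨ solve 5 (λ p q c a b → p :* (c :* a) :+ q :* (c :* b) := c :* (p :* a :+ q :* b))
           refl p₀ (1# - p₀) c _ _ ⟩
    c * 𝔼 p f ∎
    where
    p₀ = p Fin.zero
    p′ = p ∘ Fin.suc

  𝔼-sum : ∀ {m} (p : Fin k → ℝ) (F : Fin m → Subset k → ℝ) →
    𝔼 p (λ S → sum λ e → F e S) ≈ sum λ e → 𝔼 p (F e)
  𝔼-sum {m = zero}  p F = 𝔼-const p 0#
  𝔼-sum {m = suc m} p F = trans (𝔼-+ p _ _) (+-congˡ (𝔼-sum p (F ∘ Fin.suc)))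

  𝔼-mono-≤ : IsProbability p → (∀ S → Supported p S → f S ≤ g S) → 𝔼 p f ≤ 𝔼 p g
  𝔼-mono-≤ {zero}  p∈[0,1] f≤g = f≤g [] λ ()
  𝔼-mono-≤ {suc k} {p} {f} {g} p∈[0,1] f≤g = +-mono-≤
    true-part
    (*-monoˡ-≤ (x≤y⇒0≤y-x (proj₂ (p∈[0,1] Fin.zero)))
      (𝔼-mono-≤ (p∈[0,1] ∘ Fin.suc) λ S supp → f≤g (false ∷ S) (λ { (Fin.suc i) → supp i })))
    where
    p₀ = p Fin.zero
    true-part : p₀ * 𝔼 (p ∘ Fin.suc) (f ∘ (true ∷_)) ≤ p₀ * 𝔼 (p ∘ Fin.suc) (g ∘ (true ∷_))
    true-part with em {P = p₀ ≈ 0#}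
    ... | yes p₀≈0 = ≤-reflexive
      (trans (*-congʳ p₀≈0) (trans (trans (zeroˡ _) (sym (zeroˡ _))) (*-congʳ (sym p₀≈0))))
    ... | no  p₀≉0 = *-monoˡ-≤ (proj₁ (p∈[0,1] Fin.zero))
      (𝔼-mono-≤ (p∈[0,1] ∘ Fin.suc) λ S supp →
        f≤g (true ∷ S) (λ { Fin.zero _ → p₀≉0 ; (Fin.suc i) → supp i }))

  mean : (Fin k → ℝ) → (Fin k → ℝ) → ℝ
  mean p u = sum λ i → p i * u i

  𝔼-sumOver : ∀ (p u : Fin k → ℝ) → 𝔼 p (λ S → sumOver S u) ≈ mean p u
  𝔼-sumOver {zero}  p u = refl
  𝔼-sumOver {suc k} p u = begin-equality
    p₀ * 𝔼 p′ (λ S → u₀ + sumOver S u′) + (1# - p₀) * 𝔼 p′ (λ S → 0# + sumOver S u′)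
      ≈⟨ +-cong (*-congˡ (shift u₀)) (*-congˡ (shift 0#)) ⟩
    p₀ * (u₀ + mean p′ u′) + (1# - p₀) * (0# + mean p′ u′)
      ≈⟨ solve 3 (λ p u s → p :* (u :+ s) :+ (con (+ 1) :- p) :* (con (+ 0) :+ s) := p :* u :+ s) refl p₀ u₀ _ ⟩
    mean p u ∎
    where
    p₀ = p Fin.zero
    p′ = p ∘ Fin.suc
    u₀ = u Fin.zero
    u′ = u ∘ Fin.suc
    shift : ∀ c → 𝔼 p′ (λ S → c + sumOver S u′) ≈ c + mean p′ u′
    shift c = trans (𝔼-+ p′ _ _) (+-cong (𝔼-const p′ c) (𝔼-sumOver p′ u′))

  secondMoment : ∀ {u W} → IsProbability p → (∀ i → 0# ≤ u i) → (∀ i → u i ≤ W) →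
    𝔼 p (λ S → sumOver S u * sumOver S u) ≤ (mean p u + W) * mean p u
  secondMoment {zero}  {W = W} p∈[0,1] 0≤u u≤W = ≤-reflexive
    (solve 1 (λ W → con (+ 0) :* con (+ 0) := (con (+ 0) :+ W) :* con (+ 0)) refl W)
  secondMoment {suc k} {p} {u} {W} p∈[0,1] 0≤u u≤W = begin
    p₀ * 𝔼 p′ (λ S → (u₀ + sumOver S u′) * (u₀ + sumOver S u′))
      + (1# - p₀) * 𝔼 p′ (λ S → (0# + sumOver S u′) * (0# + sumOver S u′))
      ≈⟨ +-cong (*-congˡ (shift u₀)) (*-congˡ (shift 0#)) ⟩
    p₀ * (u₀ * u₀ + (u₀ + u₀) * μ + M) + (1# - p₀) * (0# * 0# + (0# + 0#) * μ + M)
      ≈⟨ solve 4 (λ p u μ M → p :* (u :* u :+ (u :+ u) :* μ :+ M)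
             :+ (con (+ 1) :- p) :* (con (+ 0) :* con (+ 0) :+ (con (+ 0) :+ con (+ 0)) :* μ :+ M)
           := M :+ (p :* (u :* u) :+ p :* (u :+ u) :* μ)) refl p₀ u₀ μ M ⟩
    M + (p₀ * (u₀ * u₀) + p₀ * (u₀ + u₀) * μ)
      ≤⟨ +-mono-≤ (secondMoment (p∈[0,1] ∘ Fin.suc) (0≤u ∘ Fin.suc) (u≤W ∘ Fin.suc))
           (+-monoˡ-≤ _ (*-monoˡ-≤ 0≤p₀ (*-monoʳ-≤ 0≤u₀ (u≤W Fin.zero)))) ⟩
    (μ + W) * μ + (p₀ * (W * u₀) + p₀ * (u₀ + u₀) * μ)
      ≤⟨ ≤-by (p₀ * u₀ * (p₀ * u₀)) (square-nonNegative _)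
           (solve 4 (λ p u μ W → (μ :+ W) :* μ :+ (p :* (W :* u) :+ p :* (u :+ u) :* μ) :+ p :* u :* (p :* u)
             := ((p :* u :+ μ) :+ W) :* (p :* u :+ μ)) refl p₀ u₀ μ W) ⟩
    (mean p u + W) * mean p u ∎
    where
    p₀ = p Fin.zero
    p′ = p ∘ Fin.suc
    u₀ = u Fin.zero
    u′ = u ∘ Fin.suc
    0≤p₀ = proj₁ (p∈[0,1] Fin.zero)
    0≤u₀ = 0≤u Fin.zero
    μ = mean p′ u′
    M = 𝔼 p′ (λ S → sumOver S u′ * sumOver S u′)
    shift : ∀ c → 𝔼 p′ (λ S → (c + sumOver S u′) * (c + sumOver S u′)) ≈ c * c + (c + c) * μ + M
    shift c = begin-equality
      𝔼 p′ (λ S → (c + sumOver S u′) * (c + sumOver S u′))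
        ≈⟨ 𝔼-cong p′ (λ S → solve 2 (λ c x → (c :+ x) :* (c :+ x) := c :* c :+ (c :+ c) :* x :+ x :* x) refl c (sumOver S u′)) ⟩
      𝔼 p′ (λ S → c * c + (c + c) * sumOver S u′ + sumOver S u′ * sumOver S u′)
        ≈⟨ trans (𝔼-+ p′ _ _) (+-congʳ (𝔼-+ p′ _ _)) ⟩
      𝔼 p′ (λ S → c * c) + 𝔼 p′ (λ S → (c + c) * sumOver S u′) + M
        ≈⟨ +-congʳ (+-cong (𝔼-const p′ _) (trans (𝔼-* p′ _ _) (*-congˡ (𝔼-sumOver p′ u′)))) ⟩
      c * c + (c + c) * μ + M ∎

  𝔼-exp-sumOver : ∀ {u v} → IsProbability p → (∀ i → exp (u i) ≤ 1# + v i) →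
    𝔼 p (λ S → exp (sumOver S u)) ≤ exp (mean p v)
  𝔼-exp-sumOver {zero}  p∈[0,1] expu≤1+v = ≤-refl
  𝔼-exp-sumOver {suc k} {p} {u} {v} p∈[0,1] expu≤1+v = begin
    p₀ * 𝔼 p′ (λ S → exp (u₀ + sumOver S u′)) + (1# - p₀) * 𝔼 p′ (λ S → exp (0# + sumOver S u′))
      ≈⟨ +-cong (*-congˡ (shift u₀)) (*-congˡ (trans (shift 0#) (*-congʳ exp-0))) ⟩
    p₀ * (exp u₀ * M) + (1# - p₀) * (1# * M)
      ≈⟨ solve 3 (λ p e M → p :* (e :* M) :+ (con (+ 1) :- p) :* (con (+ 1) :* M)
           := (p :* e :+ (con (+ 1) :- p)) :* M) refl p₀ (exp u₀) M ⟩
    (p₀ * exp u₀ + (1# - p₀)) * M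
      ≤⟨ *-mono-≤ (+-nonNegative (*-nonNegative 0≤p₀ (<⇒≤ (exp-positive u₀))) 0≤1-p₀)
           factor (≤-trans (≤-reflexive (sym (𝔼-const p′ 0#)))
             (𝔼-mono-≤ (p∈[0,1] ∘ Fin.suc) λ S _ → <⇒≤ (exp-positive _)))
           (𝔼-exp-sumOver (p∈[0,1] ∘ Fin.suc) (expu≤1+v ∘ Fin.suc)) ⟩
    exp (p₀ * v₀) * exp (mean p′ (v ∘ Fin.suc))
      ≈⟨ exp-+ _ _ ⟨
    exp (mean p v) ∎
    where
    p₀ = p Fin.zero
    p′ = p ∘ Fin.suc
    u₀ = u Fin.zero
    u′ = u ∘ Fin.suc
    v₀ = v Fin.zero
    0≤p₀ = proj₁ (p∈[0,1] Fin.zero)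
    0≤1-p₀ = x≤y⇒0≤y-x (proj₂ (p∈[0,1] Fin.zero))
    M = 𝔼 p′ (λ S → exp (sumOver S u′))
    shift : ∀ c → 𝔼 p′ (λ S → exp (c + sumOver S u′)) ≈ exp c * M
    shift c = trans (𝔼-cong p′ λ S → exp-+ c (sumOver S u′)) (𝔼-* p′ _ _)
    factor : p₀ * exp u₀ + (1# - p₀) ≤ exp (p₀ * v₀)
    factor = begin
      p₀ * exp u₀ + (1# - p₀)
        ≤⟨ +-monoˡ-≤ _ (*-monoˡ-≤ 0≤p₀ (expu≤1+v Fin.zero)) ⟩
      p₀ * (1# + v₀) + (1# - p₀)
        ≈⟨ solve 2 (λ p v → p :* (con (+ 1) :+ v) :+ (con (+ 1) :- p) := con (+ 1) :+ p :* v) refl p₀ v₀ ⟩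
      1# + p₀ * v₀
        ≤⟨ 1+x≤exp _ ⟩
      exp (p₀ * v₀) ∎

  -- The Paley–Zygmund inequality; linearly, by integrating
  -- 4εμ(X - (1 - ε)μ) ≤ 4μ² 𝟙(X ≥ (1 - ε)μ) + ε²X².
  lowerTail : ∀ {w ε} → IsProbability p → (∀ i → 0# ≤ w i) → (∀ i → w i ≤ mean p w) →
    0# ≤ ε → ε ≤ 1# →
    ε * ε ≤ fromℕ 2 * 𝔼 p (λ S → 𝟙 ((1# - ε) * mean p w ≤ sumOver S w))
  lowerTail {p = p} {w} {ε} p∈[0,1] 0≤w w≤μ 0≤ε ε≤1 with em {P = 0# < mean p w}
  ... | no μ≯0 = begin
    ε * ε
      ≤⟨ *-mono-≤ 0≤ε ε≤1 0≤ε ε≤1 ⟩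
    1# * 1#
      ≤⟨ ≤-by 1# 0≤1 (solve 0 (con (+ 1) :* con (+ 1) :+ con (+ 1) := con (+ 2) :* con (+ 1)) refl) ⟩
    fromℕ 2 * 1#
      ≈⟨ *-congˡ (trans (𝔼-cong p λ S → 𝟙-true (always S)) (𝔼-const p 1#)) ⟨
    fromℕ 2 * 𝔼 p (λ S → 𝟙 ((1# - ε) * mean p w ≤ sumOver S w)) ∎
    where
    always : ∀ S → (1# - ε) * mean p w ≤ sumOver S w
    always S = begin
      (1# - ε) * mean p w   ≤⟨ *-monoˡ-≤ (x≤y⇒0≤y-x ε≤1) μ≤0 ⟩
      (1# - ε) * 0#         ≈⟨ zeroʳ _ ⟩
      0#                    ≤⟨ sumOver-nonNegative S 0≤w ⟩
      sumOver S w           ∎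
      where
      μ≤0 : mean p w ≤ 0#
      μ≤0 = decidable-stable em λ μ≰0 → μ≯0 (≰⇒> μ≰0)
  ... | yes 0<μ = *-cancelʳ-≤ (*-positive (fromℕ-positive 1) (*-positive 0<μ 0<μ)) (begin
    ε * ε * (fromℕ 2 * (μ * μ))
      ≈⟨ solve 2 (λ ε μ → ε :* ε :* (con (+ 2) :* (μ :* μ))
           := (con (+ 4) :* ε :* μ) :* (μ :- (con (+ 1) :- ε) :* μ) :- ε :* ε :* ((μ :+ μ) :* μ)) refl ε μ ⟩
    c * (μ - (1# - ε) * μ) - ε * ε * ((μ + μ) * μ)
      ≈⟨ +-congʳ (*-congˡ (+-cong (𝔼-sumOver p w) (𝔼-const p _))) ⟨
    c * (𝔼 p X + 𝔼 p (λ _ → - ((1# - ε) * μ))) - ε * ε * ((μ + μ) * μ)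
      ≈⟨ +-congʳ (trans (𝔼-* p c _) (*-congˡ (𝔼-+ p _ _))) ⟨
    𝔼 p (λ S → c * (X S - (1# - ε) * μ)) - ε * ε * ((μ + μ) * μ)
      ≤⟨ -‿mono-≤ (𝔼-mono-≤ p∈[0,1] λ S _ → pointwise S)
           (*-monoˡ-≤ (square-nonNegative ε) (secondMoment p∈[0,1] 0≤w w≤μ)) ⟩
    𝔼 p (λ S → fromℕ 4 * (μ * μ) * A S + ε * ε * (X S * X S)) - ε * ε * 𝔼 p (λ S → X S * X S)
      ≈⟨ +-congʳ (trans (𝔼-+ p _ _) (+-cong (𝔼-* p _ _) (𝔼-* p _ _))) ⟩
    (fromℕ 4 * (μ * μ) * 𝔼 p A + ε * ε * 𝔼 p (λ S → X S * X S)) - ε * ε * 𝔼 p (λ S → X S * X S)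
      ≈⟨ solve 3 (λ μ a b → (con (+ 4) :* (μ :* μ) :* a :+ b) :- b := con (+ 2) :* a :* (con (+ 2) :* (μ :* μ)))
           refl μ (𝔼 p A) _ ⟩
    fromℕ 2 * 𝔼 p A * (fromℕ 2 * (μ * μ)) ∎)
    where
    μ = mean p w
    c = fromℕ 4 * ε * μ
    X = λ S → sumOver S w
    A = λ S → 𝟙 ((1# - ε) * μ ≤ X S)
    0≤c : 0# ≤ c
    0≤c = *-nonNegative (*-nonNegative (fromℕ-nonNegative 4) 0≤ε) (<⇒≤ 0<μ)
    pointwise : ∀ S → c * (X S - (1# - ε) * μ) ≤ fromℕ 4 * (μ * μ) * A S + ε * ε * (X S * X S)
    pointwise S = by-cases em
      where
      θ = (1# - ε) * μ
      0≤θ : 0# ≤ θ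
      0≤θ = *-nonNegative (x≤y⇒0≤y-x ε≤1) (<⇒≤ 0<μ)
      by-cases : Dec (θ ≤ X S) → c * (X S - θ) ≤ fromℕ 4 * (μ * μ) * A S + ε * ε * (X S * X S)
      by-cases (yes θ≤X) = begin
        c * (X S - θ)
          ≤⟨ ≤-by ((ε * X S - fromℕ 2 * μ) * (ε * X S - fromℕ 2 * μ) + c * θ)
               (+-nonNegative (square-nonNegative _) (*-nonNegative 0≤c 0≤θ))
               (solve 4 (λ ε μ x θ → con (+ 4) :* ε :* μ :* (x :- θ)
                  :+ ((ε :* x :- con (+ 2) :* μ) :* (ε :* x :- con (+ 2) :* μ) :+ con (+ 4) :* ε :* μ :* θ)
                  := con (+ 4) :* (μ :* μ) :* con (+ 1) :+ ε :* ε :* (x :* x)) refl ε μ (X S) θ) ⟩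
        fromℕ 4 * (μ * μ) * 1# + ε * ε * (X S * X S)
          ≈⟨ +-congʳ (*-congˡ (𝟙-true θ≤X)) ⟨
        fromℕ 4 * (μ * μ) * A S + ε * ε * (X S * X S) ∎
      by-cases (no θ≰X) = begin
        c * (X S - θ)
          ≤⟨ *-monoˡ-≤ 0≤c (≤-trans (-‿mono-≤ (<⇒≤ (≰⇒> θ≰X)) ≤-refl) (≤-reflexive (-‿inverseʳ θ))) ⟩
        c * 0#
          ≈⟨ zeroʳ c ⟩
        0#
          ≤⟨ +-nonNegative (*-nonNegative (*-nonNegative (fromℕ-nonNegative 4) (square-nonNegative μ)) (𝟙-nonNegative _))
               (*-nonNegative (square-nonNegative ε) (square-nonNegative (X S))) ⟩
        fromℕ 4 * (μ * μ) * A S + ε * ε * (X S * X S) ∎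

  chernoff : ∀ {a : Fin k → ℝ} {c} β t → IsProbability p → 0# < c →
    (∀ i → 0# ≤ a i) → (∀ i → a i ≤ c) → mean p a ≤ c → 0# ≤ t →
    𝔼 p (λ S → 𝟙 (¬ (sumOver S a ≤ β * c))) ≤ exp (exp t - 1# - t * β)
  chernoff {p = p} {a} {c} β t p∈[0,1] 0<c 0≤a a≤c mean≤c 0≤t = begin
    𝔼 p (λ S → 𝟙 (¬ (sumOver S a ≤ β * c)))
      ≤⟨ 𝔼-mono-≤ p∈[0,1] (λ S _ → pointwise S) ⟩
    𝔼 p (λ S → exp (- (t * β)) * exp (sumOver S (λ i → s * a i)))
      ≈⟨ 𝔼-* p _ _ ⟩
    exp (- (t * β)) * 𝔼 p (λ S → exp (sumOver S (λ i → s * a i)))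
      ≤⟨ *-monoˡ-≤ (<⇒≤ (exp-positive _)) (≤-trans (𝔼-exp-sumOver p∈[0,1] convex) (exp-mono-≤ exponent)) ⟩
    exp (- (t * β)) * exp (exp t - 1#)
      ≈⟨ *-comm _ _ ⟩
    exp (exp t - 1#) * exp (- (t * β))
      ≈⟨ exp-+ _ _ ⟨
    exp (exp t - 1# - t * β) ∎
    where
    s = t * c ⁻¹
    0≤c⁻¹ = <⇒≤ (⁻¹-positive 0<c)
    convex : ∀ i → exp (s * a i) ≤ 1# + a i * c ⁻¹ * (exp t - 1#)
    convex i = ≤-trans
      (≤-reflexive (exp-cong (solve 3 (λ t d a → t :* d :* a := t :* (a :* d)) refl t (c ⁻¹) (a i))))
      (exp-convex t (*-nonNegative (0≤a i) 0≤c⁻¹)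
        (x≤y*z⇒x*z⁻¹≤y 0<c (≤-trans (a≤c i) (≤-reflexive (sym (*-identityˡ c))))))
    1≤exp-t : 1# ≤ exp t
    1≤exp-t = ≤-trans (≤-by t 0≤t refl) (1+x≤exp t)
    exponent : mean p (λ i → a i * c ⁻¹ * (exp t - 1#)) ≤ exp t - 1#
    exponent = begin
      mean p (λ i → a i * c ⁻¹ * (exp t - 1#))
        ≈⟨ sum-cong-≋ (λ i → solve 4 (λ p a d e → p :* (a :* d :* e) := (d :* e) :* (p :* a)) refl (p i) (a i) (c ⁻¹) (exp t - 1#)) ⟩
      sum (λ i → (c ⁻¹ * (exp t - 1#)) * (p i * a i))
        ≈⟨ *-distribˡ-sum _ (λ i → p i * a i) ⟨
      (c ⁻¹ * (exp t - 1#)) * mean p a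
        ≤⟨ *-monoˡ-≤ (*-nonNegative 0≤c⁻¹ (x≤y⇒0≤y-x 1≤exp-t)) mean≤c ⟩
      (c ⁻¹ * (exp t - 1#)) * c
        ≈⟨ solve 3 (λ d e c → (d :* e) :* c := e :* (d :* c)) refl (c ⁻¹) _ c ⟩
      (exp t - 1#) * (c ⁻¹ * c)
        ≈⟨ trans (*-congˡ (⁻¹-inverseˡ (>⇒≉0 0<c))) (*-identityʳ _) ⟩
      exp t - 1# ∎
    pointwise : ∀ S → 𝟙 (¬ (sumOver S a ≤ β * c)) ≤ exp (- (t * β)) * exp (sumOver S (λ i → s * a i))
    pointwise S = by-cases em
      where
      by-cases : Dec (¬ (sumOver S a ≤ β * c)) →
        𝟙 (¬ (sumOver S a ≤ β * c)) ≤ exp (- (t * β)) * exp (sumOver S (λ i → s * a i))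
      by-cases (no  ¬X≰βc) = ≤-trans (≤-reflexive (𝟙-false ¬X≰βc))
        (*-nonNegative (<⇒≤ (exp-positive _)) (<⇒≤ (exp-positive _)))
      by-cases (yes X≰βc) = begin
        𝟙 (¬ (sumOver S a ≤ β * c))
          ≈⟨ 𝟙-true X≰βc ⟩
        1#
          ≈⟨ exp-neg (t * β) ⟨
        exp (t * β) * exp (- (t * β))
          ≈⟨ *-comm _ _ ⟩
        exp (- (t * β)) * exp (t * β)
          ≤⟨ *-monoˡ-≤ (<⇒≤ (exp-positive _)) (exp-mono-≤ tβ≤) ⟩
        exp (- (t * β)) * exp (sumOver S (λ i → s * a i)) ∎
        where
        tβ≤ : t * β ≤ sumOver S (λ i → s * a i)
        tβ≤ = begin
          t * β                         ≈⟨ *-identityʳ _ ⟨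
          t * β * 1#                    ≈⟨ *-congˡ (⁻¹-inverseˡ (>⇒≉0 0<c)) ⟨
          t * β * (c ⁻¹ * c)            ≈⟨ solve 4 (λ t β d c → t :* β :* (d :* c) := t :* d :* (β :* c)) refl t β (c ⁻¹) c ⟩
          s * (β * c)                   ≤⟨ *-monoˡ-≤ (*-nonNegative 0≤t 0≤c⁻¹) (<⇒≤ (≰⇒> X≰βc)) ⟩
          s * sumOver S a               ≈⟨ sumOver-* S s a ⟨
          sumOver S (λ i → s * a i)     ∎

  -- The optimal t would be ln β; this one has eᵗ ≤ β by e¹⁻ʸ ≤ 1/y for y = ℓ/κ
  -- and makes tβ = κL + β - L exactly.
  opaque
    chernoffExponent : ∀ {κ L} → fromℕ 5 ≤ κ → 1# < L →
      ∃ λ t → 0# ≤ t × exp t - 1# - t * (κ * L * ln L ⁻¹) ≤ - (fromℕ 4 * L)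
    chernoffExponent {κ} {L} 5≤κ 1<L = t , 0≤t , (begin
      exp t - 1# - t * β
        ≤⟨ -‿mono-≤ (-‿mono-≤ exp-t≤β 0≤1) ≤-refl ⟩
      β - 0# - t * β
        ≈⟨ +-congˡ (-‿cong tβ≈) ⟩
      β - 0# - (κ * L + β - L)
        ≈⟨ solve 3 (λ β κ L → β :- con (+ 0) :- (κ :* L :+ β :- L) := L :- κ :* L) refl β κ L ⟩
      L - κ * L
        ≤⟨ -‿mono-≤ ≤-refl (*-monoʳ-≤ (<⇒≤ 0<L) 5≤κ) ⟩
      L - fromℕ 5 * L
        ≈⟨ solve 1 (λ L → L :- con (+ 5) :* L := :- (con (+ 4) :* L)) refl L ⟩
      - (fromℕ 4 * L) ∎)
      where
      0<κ : 0# < κ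
      0<κ = <-≤-trans (fromℕ-positive 4) 5≤κ
      0<L : 0# < L
      0<L = ≤-<-trans 0≤1 1<L
      ℓ : ℝ
      ℓ = ln L
      0<ℓ : 0# < ℓ
      0<ℓ = exp-cancel-< (≤-<-trans (≤-reflexive exp-0) (<-≤-trans 1<L (≤-exp-ln 0<L)))
      y : ℝ
      y = ℓ * κ ⁻¹
      0<y : 0# < y
      0<y = *-positive 0<ℓ (⁻¹-positive 0<κ)
      β : ℝ
      β = κ * L * ℓ ⁻¹
      t : ℝ
      t = (ℓ - y) + 1#
      y≤ℓ : y ≤ ℓ
      y≤ℓ = x≤y*z⇒x*z⁻¹≤y 0<κ (≤-trans (≤-reflexive (sym (*-identityʳ ℓ)))
        (*-monoˡ-≤ (<⇒≤ 0<ℓ) (≤-trans 1≤5 5≤κ)))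
        where
        1≤5 : 1# ≤ fromℕ 5
        1≤5 = ≤-by (fromℕ 4) (fromℕ-nonNegative 4) refl
      0≤t : 0# ≤ t
      0≤t = +-nonNegative (x≤y⇒0≤y-x y≤ℓ) 0≤1
      βy≈L : β * y ≈ L
      βy≈L = begin-equality
        β * y
          ≈⟨ solve 5 (λ κ L m ℓ n → κ :* L :* m :* (ℓ :* n) := L :* (κ :* n) :* (ℓ :* m)) refl κ L (ℓ ⁻¹) ℓ (κ ⁻¹) ⟩
        L * (κ * κ ⁻¹) * (ℓ * ℓ ⁻¹)
          ≈⟨ *-cong (*-congˡ (⁻¹-inverse (>⇒≉0 0<κ))) (⁻¹-inverse (>⇒≉0 0<ℓ)) ⟩
        L * 1# * 1#
          ≈⟨ trans (*-identityʳ _) (*-identityʳ L) ⟩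
        L ∎
      βℓ≈κL : β * ℓ ≈ κ * L
      βℓ≈κL = x*y⁻¹*y≈x (κ * L) 0<ℓ
      tβ≈ : t * β ≈ κ * L + β - L
      tβ≈ = begin-equality
        t * β
          ≈⟨ solve 3 (λ ℓ y β → ((ℓ :- y) :+ con (+ 1)) :* β := β :* ℓ :+ β :- β :* y) refl ℓ y β ⟩
        β * ℓ + β - β * y
          ≈⟨ +-cong (+-congʳ βℓ≈κL) (-‿cong βy≈L) ⟩
        κ * L + β - L ∎
      exp-t≤β : exp t ≤ β
      exp-t≤β = *-cancelʳ-≤ 0<y (begin
        exp t * y
          ≈⟨ *-congʳ (trans (exp-cong (solve 2 (λ ℓ y → (ℓ :- y) :+ con (+ 1) := ℓ :+ :- (y :- con (+ 1))) refl ℓ y)) (exp-+ ℓ _)) ⟩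
        exp ℓ * exp (- (y - 1#)) * y
          ≤⟨ *-monoˡ-≤ (*-nonNegative (<⇒≤ (exp-positive _)) (<⇒≤ (exp-positive _)))
               (≤-trans (≤-reflexive (solve 1 (λ y → y := con (+ 1) :+ (y :- con (+ 1))) refl y)) (1+x≤exp (y - 1#))) ⟩
        exp ℓ * exp (- (y - 1#)) * exp (y - 1#)
          ≈⟨ solve 3 (λ a b c → a :* b :* c := a :* (c :* b)) refl _ _ _ ⟩
        exp ℓ * (exp (y - 1#) * exp (- (y - 1#)))
          ≈⟨ trans (*-congˡ (exp-neg (y - 1#))) (*-identityʳ _) ⟩
        exp ℓ
          ≤⟨ exp-ln-≤ 0<L ⟩
        L
          ≈⟨ βy≈L ⟨
        β * y ∎)

module RandomizedRounding (em : ExcludedMiddle 0ℓ) (R : CompleteOrderedField) where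
  open CompleteOrderedField R renaming (Carrier to ℝ)
  open ANF em R
  open OrderedField R
  open FiniteSums R
  open Exponential em R
  open RandomSubset em R
  open ≤-Reasoning

  private variable
    n m k : ℕ

  Pr->>=-∷ : ∀ {A : Set} (P : A → Set) c (r : Random (Subset k)) (g : Subset (suc k) → Random A) →
    Pr P (r >>= (λ S → return (c ∷ S)) >>= g) ≈ Pr P (r >>= λ S → g (c ∷ S))
  Pr->>=-∷ P c (return S)  g = refl
  Pr->>=-∷ P c (flip p r) g =
    +-cong (*-congˡ (Pr->>=-∷ P c (r true) g)) (*-congˡ (Pr->>=-∷ P c (r false) g))

  Pr-round->>= : ∀ {A : Set} (P : A → Set) (p : Fin k → ℝ) (g : Subset k → Random A) →
    Pr P (round p >>= g) ≈ 𝔼 p (λ S → Pr P (g S))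
  Pr-round->>= {zero}  P p g = refl
  Pr-round->>= {suc k} P p g = +-cong (*-congˡ (branch true)) (*-congˡ (branch false))
    where
    branch : ∀ c → Pr P (round (p ∘ Fin.suc) >>= (λ S → return (c ∷ S)) >>= g)
                 ≈ 𝔼 (p ∘ Fin.suc) (λ S → Pr P (g (c ∷ S)))
    branch c = trans (Pr->>=-∷ P c (round (p ∘ Fin.suc)) g) (Pr-round->>= P (p ∘ Fin.suc) (g ∘ (c ∷_)))

  sumOver-⊥ : ∀ (u : Fin k → ℝ) → sumOver ⊥ u ≈ 0#
  sumOver-⊥ {zero}  u = refl
  sumOver-⊥ {suc k} u = trans (+-identityˡ _) (sumOver-⊥ (u ∘ Fin.suc))

  sumOver-⁅⁆ : ∀ (i : Fin k) (u : Fin k → ℝ) → sumOver ⁅ i ⁆ u ≈ u i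
  sumOver-⁅⁆ Fin.zero    u = trans (+-congˡ (sumOver-⊥ (u ∘ Fin.suc))) (+-identityʳ _)
  sumOver-⁅⁆ (Fin.suc i) u = trans (+-identityˡ _) (sumOver-⁅⁆ i (u ∘ Fin.suc))

  module _ (I : Instance n m k) where
    open Instance I
    open Solution
    open LPPoint
    open IsFlow
    open IsLPFeasible

    netOutflow-* : ∀ {g g′} s → (∀ e → g′ e ≈ s * g e) → ∀ v →
      netOutflow I g′ v ≈ s * netOutflow I g v
    netOutflow-* {g} {g′} s g′≈sg v = begin-equality
      netOutflow I g′ v
        ≈⟨ +-cong (scale (λ e → does (src e ≟ v))) (-‿cong (scale (λ e → does (tgt e ≟ v)))) ⟩
      s * sum (λ e → if does (src e ≟ v) then g e else 0#) - s * sum (λ e → if does (tgt e ≟ v) then g e else 0#)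
        ≈⟨ solve 3 (λ s a b → s :* a :- s :* b := s :* (a :- b)) refl s _ _ ⟩
      s * netOutflow I g v ∎
      where
      if-cong : ∀ b {x y} → x ≈ y → (if b then x else 0#) ≈ (if b then y else 0#)
      if-cong true  x≈y = x≈y
      if-cong false x≈y = refl
      scale : ∀ (b : Fin m → Bool) →
        sum (λ e → if b e then g′ e else 0#) ≈ s * sum (λ e → if b e then g e else 0#)
      scale b = trans
        (sum-cong-≋ λ e → trans (if-cong (b e) (g′≈sg e)) (if-* (b e) s (g e)))
        (sym (*-distribˡ-sum s λ e → if b e then g e else 0#))

    scaleFlow : ∀ {i v v′ g g′} s → 0# ≤ s → v′ ≈ s * v → (∀ e → g′ e ≈ s * g e) →
      IsFlow I i v g → IsFlow I i v′ g′
    scaleFlow s 0≤s v′≈sv g′≈sg F .nonNegative e =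
      ≤-trans (*-nonNegative 0≤s (F .nonNegative e)) (≤-reflexive (sym (g′≈sg e)))
    scaleFlow s 0≤s v′≈sv g′≈sg F .outflow =
      trans (netOutflow-* s g′≈sg _) (trans (*-congˡ (F .outflow)) (sym v′≈sv))
    scaleFlow s 0≤s v′≈sv g′≈sg F .conservation v v≢source v≢sink =
      trans (netOutflow-* s g′≈sg v) (trans (*-congˡ (F .conservation v v≢source v≢sink)) (zeroʳ s))

    zeroFlow : ∀ i → IsFlow I i 0# (λ _ → 0#)
    zeroFlow i = record
      { nonNegative  = λ _ → ≤-refl
      ; outflow      = netOutflow-0 (source i)
      ; conservation = λ v _ _ → netOutflow-0 v
      }
      where
      netOutflow-0 : ∀ v → netOutflow I (λ _ → 0#) v ≈ 0#
      netOutflow-0 v = trans (netOutflow-* {g = λ _ → 0#} 0# (λ _ → sym (zeroˡ 0#)) v) (zeroˡ _)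

    toLPPoint : Solution I → LPPoint I
    toLPPoint s .fraction i   = if lookup (chosen s) i then 1# else 0#
    toLPPoint s .edgeFlow i e = if lookup (chosen s) i then demand i ⁻¹ * flow s i e else 0#

    demand*demand⁻¹* : ∀ i x → demand i * (demand i ⁻¹ * x) ≈ x
    demand*demand⁻¹* i x = trans (sym (*-assoc _ _ _))
      (trans (*-congʳ (⁻¹-inverse (>⇒≉0 (demand>0 i)))) (*-identityˡ x))

    toLPPoint-feasible : ∀ s → IsFeasible I s → IsLPFeasible I (toLPPoint s)
    toLPPoint-feasible s (routed , load≤) = record
      { isFlow     = λ i → flow-if i (lookup S i) (routed i ∘ lookup⇒[]= i S)
      ; jointLoad  = λ e → ≤-trans (≤-reflexive (sum-cong-≋ λ i → load-if i e (lookup S i))) (load≤ e)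
      ; singleLoad = λ i e → ≤-trans
          (≤-reflexive (load-if i e (lookup S i)))
          (capacity-if i e (lookup S i) (term≤load i e))
      ; fraction≥0 = λ i → if-nonNegative (lookup S i) 0≤1
      ; fraction≤1 = λ i → if-≤1 (lookup S i)
      }
      where
      S = chosen s
      flow-if : ∀ i b → (b ≡ true → IsFlow I i (demand i) (flow s i)) →
        IsFlow I i (if b then 1# else 0#) (λ e → if b then demand i ⁻¹ * flow s i e else 0#)
      flow-if i true  F = scaleFlow (demand i ⁻¹) (<⇒≤ (⁻¹-positive (demand>0 i)))
        (sym (⁻¹-inverseˡ (>⇒≉0 (demand>0 i)))) (λ _ → refl) (F ≡.refl)
      flow-if i false F = zeroFlow i
      load-if : ∀ i e b → demand i * (if b then demand i ⁻¹ * flow s i e else 0#)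
                        ≈ (if b then flow s i e else 0#)
      load-if i e true  = demand*demand⁻¹* i (flow s i e)
      load-if i e false = zeroʳ _
      term-nonNegative : ∀ i e b → (b ≡ true → IsFlow I i (demand i) (flow s i)) →
        0# ≤ (if b then flow s i e else 0#)
      term-nonNegative i e true  F = F ≡.refl .nonNegative e
      term-nonNegative i e false F = ≤-refl
      term≤load : ∀ i e → (if lookup S i then flow s i e else 0#) ≤ capacity e
      term≤load i e = ≤-trans
        (term≤sum (λ j → term-nonNegative j e (lookup S j) (routed j ∘ lookup⇒[]= j S)) i)
        (load≤ e)
      capacity-if : ∀ i e b → (if b then flow s i e else 0#) ≤ capacity e →
        (if b then flow s i e else 0#) ≤ (if b then 1# else 0#) * capacity e
      capacity-if i e true  f≤c = ≤-trans f≤c (≤-reflexive (sym (*-identityˡ _)))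
      capacity-if i e false _   = ≤-reflexive (sym (zeroˡ _))
      if-≤1 : ∀ b → (if b then 1# else 0#) ≤ 1#
      if-≤1 true  = ≤-refl
      if-≤1 false = 0≤1

    if-1-* : ∀ b x → x * (if b then 1# else 0#) ≈ (if b then x else 0#)
    if-1-* true  x = *-identityʳ x
    if-1-* false x = zeroʳ x

    module _ (x : LPPoint I) (x-optimal : IsLPOptimal I x) where
      private
        x-feasible : IsLPFeasible I x
        x-feasible = proj₁ x-optimal

        p : Fin k → ℝ
        p = fraction x

        μ : ℝ
        μ = objective x

      p-probability : IsProbability p
      p-probability i = x-feasible .fraction≥0 i , x-feasible .fraction≤1 i

      throughput≤objective : ∀ s → IsFeasible I s → throughput s ≤ μ
      throughput≤objective s s-feasible = begin
        throughput s
          ≈⟨ sum-cong-≋ (λ i → if-1-* (lookup (chosen s) i) (weight i)) ⟨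
        objective (toLPPoint s)
          ≤⟨ proj₂ x-optimal (toLPPoint s) (toLPPoint-feasible s s-feasible) ⟩
        μ ∎

      weight≤objective : ∀ i → RoutableAlone I i → weight i ≤ μ
      weight≤objective i (g , g-isFlow , g≤c) = begin
        weight i                 ≈⟨ sumOver-⁅⁆ i weight ⟨
        sumOver ⁅ i ⁆ weight     ≤⟨ throughput≤objective alone (routed , load≤) ⟩
        μ                        ∎
        where
        alone : Solution I
        alone .chosen   = ⁅ i ⁆
        alone .flow j e = g e
        routed : FullyRouted alone
        routed j j∈⁅i⁆ with x∈⁅y⁆⇒x≡y i j∈⁅i⁆
        ... | ≡.refl = g-isFlow
        load≤ : ∀ e → load alone e ≤ capacity e
        load≤ e = ≤-trans (≤-reflexive (sumOver-⁅⁆ i λ _ → g e)) (g≤c e)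

      -- The contribution of commodity i to the load of e once it is chosen; it
      -- is 0 when fᵢ = 0, because then dᵢ fᵢ,ₑ ≤ fᵢ c(e) forces fᵢ,ₑ = 0.
      unitLoad : Fin m → Fin k → ℝ
      unitLoad e i = edgeFlow x i e * p i ⁻¹ * 1# * demand i

      edgeFlow≈0 : ∀ e i → p i ≈ 0# → edgeFlow x i e ≈ 0#
      edgeFlow≈0 e i p≈0 = antisym
        (*-cancelʳ-≤ (demand>0 i) (begin
          edgeFlow x i e * demand i   ≈⟨ *-comm _ _ ⟩
          demand i * edgeFlow x i e   ≤⟨ x-feasible .singleLoad i e ⟩
          p i * capacity e            ≈⟨ trans (*-congʳ p≈0) (zeroˡ _) ⟩
          0#                          ≈⟨ zeroˡ _ ⟨
          0# * demand i               ∎))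
        (x-feasible .isFlow i .nonNegative e)

      unitLoad≈0 : ∀ e i → p i ≈ 0# → unitLoad e i ≈ 0#
      unitLoad≈0 e i p≈0 = trans
        (*-congʳ (*-congʳ (*-congʳ (edgeFlow≈0 e i p≈0))))
        (solve 2 (λ q d → con (+ 0) :* q :* con (+ 1) :* d := con (+ 0)) refl _ _)

      p*unitLoad : ∀ e i → p i * unitLoad e i ≈ demand i * edgeFlow x i e
      p*unitLoad e i = by-cases em
        where
        by-cases : Dec (p i ≈ 0#) → p i * unitLoad e i ≈ demand i * edgeFlow x i e
        by-cases (yes p≈0) = begin-equality
          p i * unitLoad e i          ≈⟨ *-congˡ (unitLoad≈0 e i p≈0) ⟩
          p i * 0#                    ≈⟨ trans (zeroʳ _) (sym (zeroʳ _)) ⟩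
          demand i * 0#               ≈⟨ *-congˡ (edgeFlow≈0 e i p≈0) ⟨
          demand i * edgeFlow x i e   ∎
        by-cases (no p≉0) = begin-equality
          p i * unitLoad e i
            ≈⟨ solve 4 (λ p g q d → p :* (g :* q :* con (+ 1) :* d) := p :* q :* (d :* g)) refl (p i) _ (p i ⁻¹) (demand i) ⟩
          p i * p i ⁻¹ * (demand i * edgeFlow x i e)
            ≈⟨ trans (*-congʳ (⁻¹-inverse p≉0)) (*-identityˡ _) ⟩
          demand i * edgeFlow x i e ∎

      0<p : ∀ i → ¬ (p i ≈ 0#) → 0# < p i
      0<p i p≉0 = x-feasible .fraction≥0 i , λ 0≈p → p≉0 (sym 0≈p)

      unitLoad-nonNegative : ∀ e i → 0# ≤ unitLoad e i
      unitLoad-nonNegative e i = by-cases em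
        where
        by-cases : Dec (p i ≈ 0#) → 0# ≤ unitLoad e i
        by-cases (yes p≈0) = ≤-reflexive (sym (unitLoad≈0 e i p≈0))
        by-cases (no  p≉0) = *-nonNegative (*-nonNegative (*-nonNegative
          (x-feasible .isFlow i .nonNegative e) (<⇒≤ (⁻¹-positive (0<p i p≉0)))) 0≤1) (<⇒≤ (demand>0 i))

      unitLoad≤capacity : ∀ e i → unitLoad e i ≤ capacity e
      unitLoad≤capacity e i = by-cases em
        where
        by-cases : Dec (p i ≈ 0#) → unitLoad e i ≤ capacity e
        by-cases (yes p≈0) = ≤-trans (≤-reflexive (unitLoad≈0 e i p≈0)) (<⇒≤ (capacity>0 e))
        by-cases (no  p≉0) = *-cancelʳ-≤ (0<p i p≉0) (begin
          unitLoad e i * p i          ≈⟨ *-comm _ _ ⟩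
          p i * unitLoad e i          ≈⟨ p*unitLoad e i ⟩
          demand i * edgeFlow x i e   ≤⟨ x-feasible .singleLoad i e ⟩
          p i * capacity e            ≈⟨ *-comm _ _ ⟩
          capacity e * p i            ∎)

      mean-unitLoad≤capacity : ∀ e → mean p (unitLoad e) ≤ capacity e
      mean-unitLoad≤capacity e = ≤-trans (≤-reflexive (sum-cong-≋ (p*unitLoad e))) (x-feasible .jointLoad e)

      objective-rescale : ∀ S → objective (rescale I x S) ≈ sumOver S weight
      objective-rescale S = sum-cong-≋ λ i → if-1-* (lookup S i) (weight i)

      load-rescale : ∀ S e → sum (λ i → edgeFlow (rescale I x S) i e * demand i) ≈ sumOver S (unitLoad e)
      load-rescale S e = sum-cong-≋ λ i → if-*ʳ (lookup S i) _ (demand i)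
        where
        if-*ʳ : ∀ b y z → (if b then y else 0#) * z ≈ (if b then y * z else 0#)
        if-*ʳ true  y z = refl
        if-*ʳ false y z = zeroˡ z

      rescale-routed : ∀ S → Supported p S → FullyRouted (toSolution I (rescale I x S) S)
      rescale-routed S supported i i∈S = route (lookup S i) ([]=⇒lookup i∈S)
        where
        p≉0 : ¬ (p i ≈ 0#)
        p≉0 = supported i ([]=⇒lookup i∈S)
        route : ∀ b → b ≡ true →
          IsFlow I i (demand i) (λ e → (if b then edgeFlow x i e * p i ⁻¹ * 1# else 0#) * demand i)
        route true _ = scaleFlow (p i ⁻¹ * demand i)
          (*-nonNegative (<⇒≤ (⁻¹-positive (0<p i p≉0))) (<⇒≤ (demand>0 i)))
          (sym (trans (solve 3 (λ q d p → q :* d :* p := q :* p :* d) refl _ _ _)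
            (trans (*-congʳ (⁻¹-inverseˡ p≉0)) (*-identityˡ _))))
          (λ e → solve 3 (λ g q d → g :* q :* con (+ 1) :* d := q :* d :* g) refl _ _ _)
          (x-feasible .isFlow i)

      acceptable⇒approximation : ∀ {ε β} S → ε ≤ 1# → Supported p S →
        Acceptable I ε β x (rescale I x S) →
        IsApproximation I (1# - ε) β (toSolution I (rescale I x S) S)
      acceptable⇒approximation {ε} {β} S ε≤1 supported (objective≥ , load≤) = record
        { fullyRouted     = rescale-routed S supported
        ; throughputBound = λ t t-maximum → begin
            (1# - ε) * t                  ≤⟨ *-monoˡ-≤ (x≤y⇒0≤y-x ε≤1) (maximum≤objective t t-maximum) ⟩
            (1# - ε) * μ                  ≤⟨ objective≥ ⟩
            objective (rescale I x S)     ≈⟨ objective-rescale S ⟩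
            sumOver S weight              ∎
        ; loadBound       = λ e → ≤-trans (≤-reflexive (sum-cong-≋ λ i → if-if (lookup S i) _ (demand i))) (load≤ e)
        }
        where
        maximum≤objective : ∀ t → IsMaximumThroughput I t → t ≤ μ
        maximum≤objective t ((s , s-feasible , s≈t) , _) =
          ≤-trans (≤-reflexive (sym s≈t)) (throughput≤objective s s-feasible)
        if-if : ∀ b y z → (if b then (if b then y else 0#) * z else 0#) ≈ (if b then y else 0#) * z
        if-if true  y z = refl
        if-if false y z = sym (zeroˡ z)

      acceptance : ℝ → ℝ → ℝ
      acceptance ε β = 𝔼 p λ S → 𝟙 (Acceptable I ε β x (rescale I x S))

      acceptance-bound : ∀ {ε} β t → (∀ i → RoutableAlone I i) → 0# ≤ ε → ε ≤ 1# → 0# ≤ t →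
        ε * ε ≤ fromℕ 2 * (acceptance ε β + fromℕ m * exp (exp t - 1# - t * β))
      acceptance-bound {ε} β t routable 0≤ε ε≤1 0≤t = begin
        ε * ε
          ≤⟨ lowerTail p-probability (λ i → <⇒≤ (weight>0 i))
               (λ i → ≤-trans (weight≤objective i (routable i)) (≤-reflexive μ≈mean)) 0≤ε ε≤1 ⟩
        fromℕ 2 * 𝔼 p (λ S → 𝟙 ((1# - ε) * mean p weight ≤ sumOver S weight))
          ≤⟨ *-monoˡ-≤ (fromℕ-nonNegative 2) (𝔼-mono-≤ p-probability λ S _ → unionBound S) ⟩
        fromℕ 2 * 𝔼 p (λ S → 𝟙 (Acceptable I ε β x (rescale I x S)) + sum (λ e → overload e S))
          ≈⟨ *-congˡ (trans (𝔼-+ p _ _) (+-congˡ (𝔼-sum p overload))) ⟩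
        fromℕ 2 * (acceptance ε β + sum (λ e → 𝔼 p (overload e)))
          ≤⟨ *-monoˡ-≤ (fromℕ-nonNegative 2) (+-monoʳ-≤ _ (sum-mono-≤ λ e →
               chernoff β t p-probability (capacity>0 e) (unitLoad-nonNegative e)
                 (unitLoad≤capacity e) (mean-unitLoad≤capacity e) 0≤t)) ⟩
        fromℕ 2 * (acceptance ε β + sum {m} (λ _ → exp (exp t - 1# - t * β)))
          ≈⟨ *-congˡ (+-congˡ (sum-const m _)) ⟩
        fromℕ 2 * (acceptance ε β + fromℕ m * exp (exp t - 1# - t * β)) ∎
        where
        μ≈mean : μ ≈ mean p weight
        μ≈mean = sum-cong-≋ λ i → *-comm (weight i) (p i)
        overload : Fin m → Subset k → ℝ
        overload e S = 𝟙 (¬ (sumOver S (unitLoad e) ≤ β * capacity e))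
        unionBound : ∀ S → 𝟙 ((1# - ε) * mean p weight ≤ sumOver S weight)
          ≤ 𝟙 (Acceptable I ε β x (rescale I x S)) + sum (λ e → overload e S)
        unionBound S = by-cases em em
          where
          0≤overload : ∀ e → 0# ≤ overload e S
          0≤overload e = 𝟙-nonNegative _
          by-cases : Dec ((1# - ε) * mean p weight ≤ sumOver S weight) →
            Dec (∃ λ e → ¬ (sumOver S (unitLoad e) ≤ β * capacity e)) →
            𝟙 ((1# - ε) * mean p weight ≤ sumOver S weight)
              ≤ 𝟙 (Acceptable I ε β x (rescale I x S)) + sum (λ e → overload e S)
          by-cases (no μ≰X) _ = ≤-trans (≤-reflexive (𝟙-false μ≰X))
            (+-nonNegative (𝟙-nonNegative _) (sum-nonNegative 0≤overload))
          by-cases (yes μ≤X) (yes (e , overloaded)) = begin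
            𝟙 ((1# - ε) * mean p weight ≤ sumOver S weight)
              ≈⟨ trans (𝟙-true μ≤X) (sym (𝟙-true overloaded)) ⟩
            overload e S
              ≤⟨ term≤sum 0≤overload e ⟩
            sum (λ e → overload e S)
              ≤⟨ ≤-by _ (𝟙-nonNegative (Acceptable I ε β x (rescale I x S))) (+-comm _ _) ⟩
            𝟙 (Acceptable I ε β x (rescale I x S)) + sum (λ e → overload e S) ∎
          by-cases (yes μ≤X) (no noneOverloaded) = begin
            𝟙 ((1# - ε) * mean p weight ≤ sumOver S weight)
              ≈⟨ trans (𝟙-true μ≤X) (sym (𝟙-true acceptable)) ⟩
            𝟙 (Acceptable I ε β x (rescale I x S))
              ≤⟨ ≤-by _ (sum-nonNegative 0≤overload) refl ⟩
            𝟙 (Acceptable I ε β x (rescale I x S)) + sum (λ e → overload e S) ∎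
            where
            acceptable : Acceptable I ε β x (rescale I x S)
            acceptable =
              (begin
                (1# - ε) * μ                  ≈⟨ *-congˡ μ≈mean ⟩
                (1# - ε) * mean p weight      ≤⟨ μ≤X ⟩
                sumOver S weight              ≈⟨ objective-rescale S ⟨
                objective (rescale I x S)     ∎) ,
              λ e → ≤-trans (≤-reflexive (load-rescale S e))
                (decidable-stable em λ overloaded → noneOverloaded (e , overloaded))

      failure-bound : ∀ {ε β q} → ε ≤ 1# → q ≤ acceptance ε β → ∀ N →
        1# - Pr (Succeeds I (1# - ε) β) (randomizedRounding I ε β N x) ≤ exp (- (fromℕ N * q))
      failure-bound {ε} {β} {q} ε≤1 q≤ zero = begin
        1# - 𝟙 (Succeeds I (1# - ε) β nothing)   ≤⟨ -‿mono-≤ ≤-refl (𝟙-nonNegative _) ⟩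
        1# - 0#                                  ≈⟨ solve 0 (con (+ 1) :- con (+ 0) := con (+ 1)) refl ⟩
        1#                                       ≈⟨ exp-0 ⟨
        exp 0#                                   ≈⟨ exp-cong (solve 1 (λ q → con (+ 0) := :- (con (+ 0) :* q)) refl q) ⟩
        exp (- (0# * q))                         ∎
      failure-bound {ε} {β} {q} ε≤1 q≤ (suc N) = begin
        1# - Pr Success (randomizedRounding I ε β (suc N) x)
          ≈⟨ +-congˡ (-‿cong (Pr-round->>= Success p _)) ⟩
        1# - 𝔼 p (λ S → Pr Success (next S em))
          ≤⟨ -‿mono-≤ ≤-refl (𝔼-mono-≤ p-probability λ S supported → next-bound S supported em) ⟩
        1# - 𝔼 p (λ S → r + (1# - r) * 𝟙 (Acc S))
          ≈⟨ +-congˡ (-‿cong (trans (𝔼-+ p _ _) (+-cong (𝔼-const p r) (𝔼-* p _ _)))) ⟩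
        1# - (r + (1# - r) * a)
          ≈⟨ solve 2 (λ r a → con (+ 1) :- (r :+ (con (+ 1) :- r) :* a) := (con (+ 1) :- a) :* (con (+ 1) :- r)) refl r a ⟩
        (1# - a) * (1# - r)
          ≤⟨ *-monoˡ-≤ (x≤y⇒0≤y-x a≤1) (failure-bound ε≤1 q≤ N) ⟩
        (1# - a) * exp (- (fromℕ N * q))
          ≤⟨ *-monoʳ-≤ (<⇒≤ (exp-positive _)) (≤-trans (-‿mono-≤ ≤-refl q≤) (1+x≤exp (- q))) ⟩
        exp (- q) * exp (- (fromℕ N * q))
          ≈⟨ exp-+ _ _ ⟨
        exp (- q - fromℕ N * q)
          ≈⟨ exp-cong (solve 2 (λ q N → :- q :- N :* q := :- ((con (+ 1) :+ N) :* q)) refl q (fromℕ N)) ⟩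
        exp (- (fromℕ (suc N) * q)) ∎
        where
        Success = Succeeds I (1# - ε) β
        Acc = λ S → Acceptable I ε β x (rescale I x S)
        a = acceptance ε β
        r = Pr Success (randomizedRounding I ε β N x)
        next : ∀ S → Dec (Acc S) → Random (Maybe (Solution I))
        next S d = if does d then return (just (toSolution I (rescale I x S) S)) else randomizedRounding I ε β N x
        a≤1 : a ≤ 1#
        a≤1 = ≤-trans (𝔼-mono-≤ p-probability λ S _ → 𝟙≤1 (Acc S)) (≤-reflexive (𝔼-const p 1#))
        next-bound : ∀ S → Supported p S → (d : Dec (Acc S)) →
          r + (1# - r) * (if does d then 1# else 0#) ≤ Pr Success (next S d)
        next-bound S supported (yes acc) = ≤-reflexive (trans
          (solve 1 (λ r → r :+ (con (+ 1) :- r) :* con (+ 1) := con (+ 1)) refl r)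
          (sym (𝟙-true (_ , ≡.refl , acceptable⇒approximation S ε≤1 supported acc))))
        next-bound S supported (no _) = ≤-reflexive
          (solve 1 (λ r → r :+ (con (+ 1) :- r) :* con (+ 0) := r) refl r)

module Constants (em : ExcludedMiddle 0ℓ) (R : CompleteOrderedField) where
  open CompleteOrderedField R renaming (Carrier to ℝ)
  open ANF em R
  open OrderedField R
  open Exponential em R
  open RandomSubset em R
  open RandomizedRounding em R
  open ≤-Reasoning
  open import Algebra.Properties.Semiring.Mult semiring using (×1-homo-*)

  b₀ : ℝ
  b₀ = fromℕ 185 * fromℕ 100 ⁻¹

  fromℕ-*-≤ : ∀ {i j k l} → i ℕ.* j ℕ.≤ k ℕ.* l → fromℕ i * fromℕ j ≤ fromℕ k * fromℕ l
  fromℕ-*-≤ {i} {j} {k} {l} ij≤kl = begin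
    fromℕ i * fromℕ j   ≈⟨ ×1-homo-* i j ⟨
    fromℕ (i ℕ.* j)     ≤⟨ fromℕ-mono-≤ ij≤kl ⟩
    fromℕ (k ℕ.* l)     ≈⟨ ×1-homo-* k l ⟩
    fromℕ k * fromℕ l   ∎

  5≤3b₀ : fromℕ 5 ≤ fromℕ 3 * b₀
  5≤3b₀ = ≤-trans
    (x*y≤z⇒x≤z*y⁻¹ (fromℕ-positive 99) (fromℕ-*-≤ {5} {100} {3} {185} (ℕ.≤ᵇ⇒≤ 500 555 _)))
    (≤-reflexive (*-assoc _ _ _))

  1<b₀ : 1# < b₀
  1<b₀ = ≰⇒> λ b₀≤1 → <⇒≱ (fromℕ-positive 1) (begin
    fromℕ 2             ≈⟨ solve 0 (con (+ 2) := con (+ 5) :- con (+ 3) :* con (+ 1)) refl ⟩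
    fromℕ 5 - fromℕ 3 * 1# ≤⟨ -‿mono-≤ 5≤3b₀ (*-monoˡ-≤ (fromℕ-nonNegative 3) b₀≤1) ⟩
    fromℕ 3 * b₀ - fromℕ 3 * b₀ ≈⟨ -‿inverseʳ _ ⟩
    0#                  ∎)

  module _ {m : ℕ} (9≤m : 9 ℕ.≤ m) where

    9≤fromℕ : fromℕ 9 ≤ fromℕ m
    9≤fromℕ = fromℕ-mono-≤ 9≤m

    0<fromℕ : 0# < fromℕ m
    0<fromℕ = <-≤-trans (fromℕ-positive 8) 9≤fromℕ

    fromℕ⁻¹<b₀ : fromℕ m ⁻¹ < b₀
    fromℕ⁻¹<b₀ = ≤-<-trans (*-cancelʳ-≤ 0<fromℕ (begin
      fromℕ m ⁻¹ * fromℕ m   ≈⟨ ⁻¹-inverseˡ (>⇒≉0 0<fromℕ) ⟩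
      1#                     ≤⟨ ≤-by (fromℕ 8) (fromℕ-nonNegative 8) refl ⟩
      fromℕ 9                ≤⟨ 9≤fromℕ ⟩
      fromℕ m                ≈⟨ *-identityˡ _ ⟨
      1# * fromℕ m           ∎)) 1<b₀

    L : ℝ
    L = ln (fromℕ m)

    m*exp[-L]≤1 : fromℕ m * exp (- L) ≤ 1#
    m*exp[-L]≤1 = ≤-trans (*-monoʳ-≤ (<⇒≤ (exp-positive _)) (≤-exp-ln 0<fromℕ)) (≤-reflexive (exp-neg L))

    exp-1≤4 : exp 1# ≤ fromℕ 4
    exp-1≤4 = begin
      exp 1#                    ≈⟨ trans (exp-cong (sym h+h≈1)) (exp-+ h h) ⟩
      exp h * exp h             ≤⟨ *-mono-≤ (<⇒≤ (exp-positive h)) exp-h≤2 (<⇒≤ (exp-positive h)) exp-h≤2 ⟩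
      fromℕ 2 * fromℕ 2         ≈⟨ solve 0 (con (+ 2) :* con (+ 2) := con (+ 4)) refl ⟩
      fromℕ 4                   ∎
      where
      h = fromℕ 2 ⁻¹
      h+h≈1 : h + h ≈ 1#
      h+h≈1 = trans (solve 1 (λ h → h :+ h := con (+ 2) :* h) refl h) (⁻¹-inverse (>⇒≉0 (fromℕ-positive 1)))
      exp-h≤2 : exp h ≤ fromℕ 2
      exp-h≤2 = *-cancelʳ-≤ (⁻¹-positive (fromℕ-positive 1)) (begin
        exp h * h               ≈⟨ *-congˡ (solve 1 (λ h → h := (h :+ h) :- h) refl h) ⟩
        exp h * (h + h - h)     ≈⟨ *-congˡ (+-congʳ h+h≈1) ⟩
        exp h * (1# - h)        ≤⟨ *-monoˡ-≤ (<⇒≤ (exp-positive h)) (1+x≤exp (- h)) ⟩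
        exp h * exp (- h)       ≈⟨ exp-neg h ⟩
        1#                      ≈⟨ ⁻¹-inverse (>⇒≉0 (fromℕ-positive 1)) ⟨
        fromℕ 2 * h             ∎)

    1<L : 1# < L
    1<L = exp-cancel-< (<-≤-trans (≤-<-trans exp-1≤4 4<9) (≤-trans 9≤fromℕ (≤-exp-ln 0<fromℕ)))
      where
      4<9 : fromℕ 4 < fromℕ 9
      4<9 = ≰⇒> λ 9≤4 → <⇒≱ (fromℕ-positive 4) (begin
        fromℕ 5             ≈⟨ solve 0 (con (+ 5) := con (+ 9) :- con (+ 4)) refl ⟩
        fromℕ 9 - fromℕ 4   ≤⟨ -‿mono-≤ 9≤4 ≤-refl ⟩
        fromℕ 4 - fromℕ 4   ≈⟨ -‿inverseʳ _ ⟩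
        0#                  ∎)

    0<L : 0# < L
    0<L = ≤-<-trans 0≤1 1<L

    -- Chernoff's bound on the probability that an edge is overloaded is exp s,
    -- which is at most m⁻⁴.
    overload≤ε² : ∀ {ε s} → fromℕ m ⁻¹ ≤ ε → s ≤ - (fromℕ 4 * L) →
      fromℕ 4 * (fromℕ m * exp s) ≤ ε * ε
    overload≤ε² {ε} {s} m⁻¹≤ε s≤ = begin
      fromℕ 4 * (M * exp s)
        ≤⟨ *-monoˡ-≤ (fromℕ-nonNegative 4) (*-monoˡ-≤ (<⇒≤ 0<fromℕ) (exp-mono-≤ s≤)) ⟩
      fromℕ 4 * (M * exp (- (fromℕ 4 * L)))
        ≈⟨ *-congˡ (*-congˡ exp[-4L]≈) ⟩
      fromℕ 4 * (M * (y * y * (y * y)))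
        ≈⟨ solve 2 (λ M y → con (+ 4) :* (M :* (y :* y :* (y :* y))) := (M :* y) :* (con (+ 4) :* y) :* (y :* y)) refl M y ⟩
      (M * y) * (fromℕ 4 * y) * (y * y)
        ≤⟨ *-mono-≤ (*-nonNegative 0≤My 0≤4y) (*-mono-≤ 0≤My m*exp[-L]≤1 0≤4y 4y≤1)
             (square-nonNegative y) (*-mono-≤ 0≤y y≤ε 0≤y y≤ε) ⟩
      1# * 1# * (ε * ε)
        ≈⟨ solve 1 (λ e → con (+ 1) :* con (+ 1) :* e := e) refl (ε * ε) ⟩
      ε * ε ∎
      where
      M = fromℕ m
      y = exp (- L)
      0≤y : 0# ≤ y
      0≤y = <⇒≤ (exp-positive (- L))
      0≤My : 0# ≤ M * y
      0≤My = *-nonNegative (<⇒≤ 0<fromℕ) 0≤y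
      0≤4y : 0# ≤ fromℕ 4 * y
      0≤4y = *-nonNegative (fromℕ-nonNegative 4) 0≤y
      4y≤1 : fromℕ 4 * y ≤ 1#
      4y≤1 = ≤-trans
        (*-monoʳ-≤ 0≤y (≤-trans (fromℕ-mono-≤ (ℕ.≤ᵇ⇒≤ 4 9 _)) 9≤fromℕ))
        m*exp[-L]≤1
      y≤ε : y ≤ ε
      y≤ε = ≤-trans
        (x*y≤z⇒x≤z*y⁻¹ 0<fromℕ (≤-trans (≤-reflexive (*-comm y M)) m*exp[-L]≤1))
        (≤-trans (≤-reflexive (*-identityˡ _)) m⁻¹≤ε)
      exp[-4L]≈ : exp (- (fromℕ 4 * L)) ≈ y * y * (y * y)
      exp[-4L]≈ = begin-equality
        exp (- (fromℕ 4 * L))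
          ≈⟨ exp-cong (solve 1 (λ L → :- (con (+ 4) :* L) := (:- L :+ :- L) :+ (:- L :+ :- L)) refl L) ⟩
        exp ((- L - L) + (- L - L))
          ≈⟨ trans (exp-+ _ _) (*-cong (exp-+ _ _) (exp-+ _ _)) ⟩
        y * y * (y * y) ∎

    acceptance-≥ : ∀ {n k} (I : Instance n m k) → (∀ i → RoutableAlone I i) →
      ∀ {ε} → fromℕ m ⁻¹ ≤ ε → ε ≤ 1# → (x : LPPoint I) (x-optimal : IsLPOptimal I x) →
      ε * ε * fromℕ 4 ⁻¹ ≤ acceptance I x x-optimal ε (loadFactor b₀ m)
    acceptance-≥ I routable {ε} m⁻¹≤ε ε≤1 x x-optimal = x≤y*z⇒x*z⁻¹≤y (fromℕ-positive 3) (begin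
      ε * ε
        ≈⟨ solve 1 (λ e → e := (e :+ e) :- e) refl (ε * ε) ⟩
      (ε * ε + ε * ε) - ε * ε
        ≤⟨ -‿mono-≤ (+-mono-≤ bound bound) (overload≤ε² m⁻¹≤ε (proj₂ (proj₂ exponent))) ⟩
      (fromℕ 2 * (a + o) + fromℕ 2 * (a + o)) - fromℕ 4 * o
        ≈⟨ solve 2 (λ a o → (con (+ 2) :* (a :+ o) :+ con (+ 2) :* (a :+ o)) :- con (+ 4) :* o := a :* con (+ 4)) refl a o ⟩
      a * fromℕ 4 ∎)
      where
      β = loadFactor b₀ m
      a = acceptance I x x-optimal ε β
      exponent = chernoffExponent 5≤3b₀ 1<L
      t = proj₁ exponent
      o = fromℕ m * exp (exp t - 1# - t * β)
      bound : ε * ε ≤ fromℕ 2 * (a + o)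
      bound = acceptance-bound I x x-optimal β t routable
        (≤-trans (<⇒≤ (⁻¹-positive 0<fromℕ)) m⁻¹≤ε) ε≤1 (proj₁ (proj₂ exponent))

    success-bound : ∀ {n k} (I : Instance n m k) → (∀ i → RoutableAlone I i) →
      ∀ {ε} → fromℕ m ⁻¹ ≤ ε → ε < 1# →
      ∀ N → IsCeiling (fromℕ 4 * L * (ε * ε) ⁻¹) N →
      ∀ (x : LPPoint I) → IsLPOptimal I x →
      1# - exp (- (1# * L))
        ≤ Pr (Succeeds I (1# - ε) (loadFactor b₀ m)) (randomizedRounding I ε (loadFactor b₀ m) N x)
    success-bound I routable {ε} m⁻¹≤ε ε<1 N (N≥ , _) x x-optimal = begin
      1# - exp (- (1# * L))
        ≤⟨ -‿mono-≤ ≤-refl (≤-trans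
             (failure-bound I x x-optimal (<⇒≤ ε<1) (acceptance-≥ I routable m⁻¹≤ε (<⇒≤ ε<1) x x-optimal) N)
             (exp-mono-≤ (neg-mono-≤ (≤-trans (≤-reflexive (*-identityˡ L)) L≤Nq)))) ⟩
      1# - (1# - success)
        ≈⟨ solve 1 (λ r → con (+ 1) :- (con (+ 1) :- r) := r) refl success ⟩
      success ∎
      where
      success = Pr (Succeeds I (1# - ε) (loadFactor b₀ m)) (randomizedRounding I ε (loadFactor b₀ m) N x)
      0<ε : 0# < ε
      0<ε = <-≤-trans (⁻¹-positive 0<fromℕ) m⁻¹≤ε
      q = ε * ε * fromℕ 4 ⁻¹
      L≤Nq : L ≤ fromℕ N * q
      L≤Nq = begin
        L
          ≈⟨ solve 1 (λ L → L := L :* con (+ 1) :* con (+ 1)) refl L ⟩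
        L * 1# * 1#
          ≈⟨ *-cong (*-congˡ (⁻¹-inverse (>⇒≉0 (fromℕ-positive 3)))) (⁻¹-inverse (>⇒≉0 (*-positive 0<ε 0<ε))) ⟨
        L * (fromℕ 4 * fromℕ 4 ⁻¹) * (ε * ε * (ε * ε) ⁻¹)
          ≈⟨ solve 5 (λ L f g e h → L :* (f :* g) :* (e :* h) := f :* L :* h :* (e :* g)) refl L _ _ _ _ ⟩
        fromℕ 4 * L * (ε * ε) ⁻¹ * q
          ≤⟨ *-monoʳ-≤ (*-nonNegative (square-nonNegative ε) (<⇒≤ (⁻¹-positive (fromℕ-positive 3)))) N≥ ⟩
        fromℕ N * q ∎

corollary5p1 :
    (em : ExcludedMiddle 0ℓ) (R : CompleteOrderedField) →
    let open CompleteOrderedField R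
        open ANF em R
    in
    Σ Carrier λ b → Σ Carrier λ C → Σ Carrier λ c′ →
      b ≈ fromℕ 185 * fromℕ 100 ⁻¹ ×
      0# < C ×
      0# < c′ ×
      (∀ {n m k : ℕ} → 9 ℕ.≤ m →
        fromℕ m ⁻¹ < b ×
        ((I : Instance n m k) →
         (∀ (i : Fin k) → RoutableAlone I i) →
         ∀ (ε : Carrier) → fromℕ m ⁻¹ ≤ ε → ε < 1# →
         ∀ (N : ℕ) → IsCeiling (C * ln (fromℕ m) * (ε * ε) ⁻¹) N →
         ∀ (x : LPPoint I) → IsLPOptimal I x →
         1# - exp (- (c′ * ln (fromℕ m)))
           ≤ Pr (Succeeds I (1# - ε) (loadFactor b m))
                (randomizedRounding I ε (loadFactor b m) N x)))
corollary5p1 em R =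
  b₀ , fromℕ 4 , 1# , refl , fromℕ-positive 3 , 0<1 , λ 9≤m →
  fromℕ⁻¹<b₀ 9≤m ,
  λ I routable ε m⁻¹≤ε ε<1 N N≥ x x-optimal →
    success-bound 9≤m I routable m⁻¹≤ε ε<1 N N≥ x x-optimal
  where
  open CompleteOrderedField R
  open OrderedField R
  open Constants em R
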